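{- Let $\mathcal{C}$ be a topos, $F:\mathcal{C}\to\mathcal{C}$ an endofunctor and $\leq$ a good order structure on $F$. Let $\alpha:X\to FX$ and $\beta:Y\to FY$ be two $F$-coalgebras, let $\ast$ be an object of $\mathcal{C}$, and let $p:\ast\to X$ and $q:\ast\to Y$ be two morphisms ("points"). Then there are a mono $r:R\rightarrowtail X\times Y$ representing a toposal AM-simulation from $\alpha$ to $\beta$ and a morphism $c:\ast\to R$ such that $r\cdot c=\langle p,q\rangle$ if and only if there are a span $X\xleftarrow{f}Z\xrightarrow{g}Y$, a $\mathcal{P}F$-coalgebra structure $\gamma:Z\to\mathcal{P}FZ$ such that $f$ is a $\mathcal{P}F$-coalgebra homomorphism from $\gamma$ to $\eta_{FX}\cdot\alpha$ and $g$ is a lax $\mathcal{P}F$-coalgebra homomorphism (with respect to $\leq_{\mathcal{P}}$) from $\gamma$ to $\eta_{FY}\cdot\beta$, and a morphism $w:\ast\to Z$ such that $f\cdot w=p$ and $g\cdot w=q$.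
   Context: A topos is a finitely complete category with power-objects: for every object $X$ there are an object $\mathcal{P}X$ and a mono $\in_X:E_X\rightarrowtail X\times\mathcal{P}X$ such that for every mono $m:R\rightarrowtail X\times Y$ there is a unique morphism $\xi_m:Y\to\mathcal{P}X$ such that $m$ is a pullback of $\in_X$ along $\mathrm{id}_X\times\xi_m$. $\mathcal{P}$ is the covariant functor given on $f:X\to Y$ by $\mathcal{P}f=\xi_{m_f}$, where $m_f$ is the mono part of the (epi, mono)-factorisation of $(f\times\mathrm{id})\cdot\in_X:E_X\to Y\times\mathcal{P}X$, and $\eta_X=\xi_{\langle\mathrm{id},\mathrm{id}\rangle}:X\to\mathcal{P}X$ (the unit of the power-object monad). $\mathcal{P}F$ denotes $\mathcal{P}\circ F$. A good order structure on an endofunctor $F$ is a preorder $\leq$ on each Hom-set of the form $\mathcal{C}(X,FY)$ such that: (1) if $\alpha\leq\beta$ in $\mathcal{C}(X,FY)$, $f:X'\to X$ and $g:Y\to Y'$, then $Fg\cdot\alpha\cdot f\leq Fg\cdot\beta\cdot f$ in $\mathcal{C}(X',FY')$; (2) if $h:X\to FZ$, $k:X\to FY$, $g:Y\to Z$ and $h\leq Fg\cdot k$ in $\mathcal{C}(X,FZ)$, then there is $k':X\to FY$ such that $k'\leq k$ in $\mathcal{C}(X,FY)$ and $h=Fg\cdot k'$. The relation $\leq_{\mathcal{P}}$ on $\mathcal{C}(X,\mathcal{P}FY)$: every $f:X\to\mathcal{P}FY$ corresponds to a mono $m_f:U_f\rightarrowtail FY\times X$, unique up to isomorphism, with $f=\xi_{m_f}$.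 For $f,g:X\to\mathcal{P}FY$, $f\leq_{\mathcal{P}}g$ if there exist a morphism $u:Z\to U_g$ and an epi $e:Z\to U_f$ such that $\pi_1\cdot m_f\cdot e\leq\pi_1\cdot m_g\cdot u$ and $\pi_2\cdot m_f\cdot e=\pi_2\cdot m_g\cdot u$. A $G$-coalgebra for an endofunctor $G$ is a morphism $\alpha:X\to GX$; a $G$-coalgebra homomorphism from $\alpha:X\to GX$ to $\beta:Y\to GY$ is a morphism $f:X\to Y$ with $Gf\cdot\alpha=\beta\cdot f$; given a preorder on Hom-sets $\mathcal{C}(X,GY)$, a lax homomorphism is a morphism $f:X\to Y$ with $Gf\cdot\alpha$ below $\beta\cdot f$ in $\mathcal{C}(X,GY)$. For $G=\mathcal{P}F$ the preorder used is $\leq_{\mathcal{P}}$. A relation from $X$ to $Y$ is a subobject of $X\times Y$. Toposal AM-simulation: a relation from $X$ to $Y$ is a toposal AM-simulation from $\alpha:X\to FX$ to $\beta:Y\to FY$ if for any mono $r:R\rightarrowtail X\times Y$ representing it there is a morphism $W:R\to\mathcal{P}FR$ such that $$\eta_{FX}\cdot\alpha\cdot\pi_1\cdot r\leq_{\mathcal{P}}\mathcal{P}F\pi_1\cdot\mathcal{P}Fr\cdot W\quad\text{and}\quad \mathcal{P}F\pi_2\cdot\mathcal{P}Fr\cdot W\leq_{\mathcal{P}}\eta_{FY}\cdot\beta\cdot\pi_2\cdot r .$$ -}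

module Defs where

open import Level using (Level; suc; _⊔_)
open import Data.Product using (Σ-syntax; ∃-syntax; _×_; _,_; proj₁; proj₂)
open import Function.Bundles using (_⇔_; mk⇔; Equivalence)
open import Relation.Binary.Core using (Rel)
open import Relation.Binary.Bundles using (Setoid)
open import Relation.Binary.Structures using (IsEquivalence; IsPreorder)
import Relation.Binary.Reasoning.Setoid as SetoidReasoning

-- Hom-sets are setoids, as usual in the absence of quotient types.
record Category (o ℓ e : Level) : Set (suc (o ⊔ ℓ ⊔ e)) where
  infix  4 _≈_ _⇒_
  infixr 9 _∘_
  field
    Obj       : Set o
    _⇒_       : Obj → Obj → Set ℓ
    _≈_       : ∀ {A B} → Rel (A ⇒ B) e
    id        : ∀ {A} → A ⇒ A
    _∘_       : ∀ {A B C} → B ⇒ C → A ⇒ B → A ⇒ C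
    ≈-equiv   : ∀ {A B} → IsEquivalence (_≈_ {A} {B})
    assoc     : ∀ {A B C D} (h : C ⇒ D) (g : B ⇒ C) (f : A ⇒ B) →
                (h ∘ g) ∘ f ≈ h ∘ (g ∘ f)
    identityˡ : ∀ {A B} (f : A ⇒ B) → id ∘ f ≈ f
    identityʳ : ∀ {A B} (f : A ⇒ B) → f ∘ id ≈ f
    ∘-resp-≈  : ∀ {A B C} {g g′ : B ⇒ C} {f f′ : A ⇒ B} →
                g ≈ g′ → f ≈ f′ → g ∘ f ≈ g′ ∘ f′

  hom-setoid : Obj → Obj → Setoid ℓ e
  hom-setoid A B = record { Carrier = A ⇒ B ; _≈_ = _≈_ ; isEquivalence = ≈-equiv }

  module Hom {A B : Obj} = IsEquivalence (≈-equiv {A} {B})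

  ∘-congˡ : ∀ {A B C} {h : B ⇒ C} {f g : A ⇒ B} → f ≈ g → h ∘ f ≈ h ∘ g
  ∘-congˡ = ∘-resp-≈ Hom.refl

  ∘-congʳ : ∀ {A B C} {h : A ⇒ B} {f g : B ⇒ C} → f ≈ g → f ∘ h ≈ g ∘ h
  ∘-congʳ eq = ∘-resp-≈ eq Hom.refl

  Mono : ∀ {A B} → A ⇒ B → Set (o ⊔ ℓ ⊔ e)
  Mono {A} m = ∀ {Z} (u v : Z ⇒ A) → m ∘ u ≈ m ∘ v → u ≈ v

  Epi : ∀ {A B} → A ⇒ B → Set (o ⊔ ℓ ⊔ e)
  Epi {_} {B} q = ∀ {Z} (u v : B ⇒ Z) → u ∘ q ≈ v ∘ q → u ≈ v

  record _≅_ (A B : Obj) : Set (ℓ ⊔ e) where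
    field
      to      : A ⇒ B
      from    : B ⇒ A
      to∘from : to ∘ from ≈ id
      from∘to : from ∘ to ≈ id

  SameSubobject : ∀ {A B C} → A ⇒ C → B ⇒ C → Set (ℓ ⊔ e)
  SameSubobject {A} {B} m n = Σ[ i ∈ A ≅ B ] (n ∘ _≅_.to i ≈ m)

  record IsPullback {P A B C} (p₁ : P ⇒ A) (p₂ : P ⇒ B) (f : A ⇒ C) (g : B ⇒ C)
         : Set (o ⊔ ℓ ⊔ e) where
    field
      commute   : f ∘ p₁ ≈ g ∘ p₂
      universal : ∀ {Q} (h₁ : Q ⇒ A) (h₂ : Q ⇒ B) → f ∘ h₁ ≈ g ∘ h₂ → Q ⇒ P
      p₁∘universal : ∀ {Q} (h₁ : Q ⇒ A) (h₂ : Q ⇒ B) (eq : f ∘ h₁ ≈ g ∘ h₂) →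
                     p₁ ∘ universal h₁ h₂ eq ≈ h₁
      p₂∘universal : ∀ {Q} (h₁ : Q ⇒ A) (h₂ : Q ⇒ B) (eq : f ∘ h₁ ≈ g ∘ h₂) →
                     p₂ ∘ universal h₁ h₂ eq ≈ h₂
      unique    : ∀ {Q} (u v : Q ⇒ P) → p₁ ∘ u ≈ p₁ ∘ v → p₂ ∘ u ≈ p₂ ∘ v → u ≈ v

  _IsPullbackOf_Along_ : ∀ {R S A B} → R ⇒ A → S ⇒ B → A ⇒ B → Set (o ⊔ ℓ ⊔ e)
  _IsPullbackOf_Along_ {R} {S} m n g = Σ[ t ∈ R ⇒ S ] IsPullback t m n g

  record EpiMonoFactorisation {A B} (f : A ⇒ B) : Set (o ⊔ ℓ ⊔ e) where
    field
      {Im}      : Obj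
      epi       : A ⇒ Im
      mono      : Im ⇒ B
      isEpi     : Epi epi
      isMono    : Mono mono
      factorise : mono ∘ epi ≈ f

record Endofunctor {o ℓ e} (𝒞 : Category o ℓ e) : Set (o ⊔ ℓ ⊔ e) where
  open Category 𝒞
  field
    F₀           : Obj → Obj
    F₁           : ∀ {A B} → A ⇒ B → F₀ A ⇒ F₀ B
    F-resp-≈     : ∀ {A B} {f g : A ⇒ B} → f ≈ g → F₁ f ≈ F₁ g
    identity     : ∀ {A} → F₁ (id {A}) ≈ id
    homomorphism : ∀ {A B C} (g : B ⇒ C) (f : A ⇒ B) → F₁ (g ∘ f) ≈ F₁ g ∘ F₁ f

record FinitelyComplete {o ℓ e} (𝒞 : Category o ℓ e) : Set (o ⊔ ℓ ⊔ e) where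
  open Category 𝒞
  infixr 7 _×ᵒ_
  field
    ⊤ᵒ       : Obj
    !        : ∀ {A} → A ⇒ ⊤ᵒ
    !-unique : ∀ {A} (u v : A ⇒ ⊤ᵒ) → u ≈ v

    _×ᵒ_     : Obj → Obj → Obj
    π₁       : ∀ {A B} → A ×ᵒ B ⇒ A
    π₂       : ∀ {A B} → A ×ᵒ B ⇒ B
    ⟨_,_⟩    : ∀ {A B Z} → Z ⇒ A → Z ⇒ B → Z ⇒ A ×ᵒ B
    π₁∘⟨⟩    : ∀ {A B Z} (f : Z ⇒ A) (g : Z ⇒ B) → π₁ ∘ ⟨ f , g ⟩ ≈ f
    π₂∘⟨⟩    : ∀ {A B Z} (f : Z ⇒ A) (g : Z ⇒ B) → π₂ ∘ ⟨ f , g ⟩ ≈ g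
    ×-unique : ∀ {A B Z} (u v : Z ⇒ A ×ᵒ B) → π₁ ∘ u ≈ π₁ ∘ v → π₂ ∘ u ≈ π₂ ∘ v → u ≈ v

    Eq          : ∀ {A B} → A ⇒ B → A ⇒ B → Obj
    equ         : ∀ {A B} (f g : A ⇒ B) → Eq f g ⇒ A
    equ-commute : ∀ {A B} (f g : A ⇒ B) → f ∘ equ f g ≈ g ∘ equ f g
    equ-lift    : ∀ {A B Z} (f g : A ⇒ B) (h : Z ⇒ A) → f ∘ h ≈ g ∘ h → Z ⇒ Eq f g
    equ∘lift    : ∀ {A B Z} (f g : A ⇒ B) (h : Z ⇒ A) (eq : f ∘ h ≈ g ∘ h) →
                  equ f g ∘ equ-lift f g h eq ≈ h
    equ-mono    : ∀ {A B} (f g : A ⇒ B) → Mono (equ f g)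

  infixr 8 _⁂_
  _⁂_ : ∀ {A B A′ B′} → A ⇒ A′ → B ⇒ B′ → A ×ᵒ B ⇒ A′ ×ᵒ B′
  f ⁂ g = ⟨ f ∘ π₁ , g ∘ π₂ ⟩

  module _ {A B C : Obj} (f : A ⇒ C) (g : B ⇒ C) where
    Pb : Obj
    Pb = Eq (f ∘ π₁) (g ∘ π₂)

    pb₁ : Pb ⇒ A
    pb₁ = π₁ ∘ equ (f ∘ π₁) (g ∘ π₂)

    pb₂ : Pb ⇒ B
    pb₂ = π₂ ∘ equ (f ∘ π₁) (g ∘ π₂)

    pb-isPullback : IsPullback pb₁ pb₂ f g
    pb-isPullback = record
      { commute      = begin
          f ∘ (π₁ ∘ k)  ≈⟨ assoc f π₁ k ⟨
          (f ∘ π₁) ∘ k  ≈⟨ equ-commute (f ∘ π₁) (g ∘ π₂) ⟩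
          (g ∘ π₂) ∘ k  ≈⟨ assoc g π₂ k ⟩
          g ∘ (π₂ ∘ k)  ∎
      ; universal    = λ h₁ h₂ eq → equ-lift _ _ ⟨ h₁ , h₂ ⟩ (fork h₁ h₂ eq)
      ; p₁∘universal = λ h₁ h₂ eq → Hom.trans (assoc π₁ k _)
          (Hom.trans (∘-congˡ (equ∘lift _ _ _ _)) (π₁∘⟨⟩ h₁ h₂))
      ; p₂∘universal = λ h₁ h₂ eq → Hom.trans (assoc π₂ k _)
          (Hom.trans (∘-congˡ (equ∘lift _ _ _ _)) (π₂∘⟨⟩ h₁ h₂))
      ; unique       = λ u v eq₁ eq₂ → equ-mono _ _ u v (×-unique _ _
          (Hom.trans (Hom.sym (assoc π₁ k u)) (Hom.trans eq₁ (assoc π₁ k v)))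
          (Hom.trans (Hom.sym (assoc π₂ k u)) (Hom.trans eq₂ (assoc π₂ k v))))
      }
      where
      k : Pb ⇒ A ×ᵒ B
      k = equ (f ∘ π₁) (g ∘ π₂)

      open module R {A} {B} = SetoidReasoning (hom-setoid A B)

      fork : ∀ {Q} (h₁ : Q ⇒ A) (h₂ : Q ⇒ B) → f ∘ h₁ ≈ g ∘ h₂ →
             (f ∘ π₁) ∘ ⟨ h₁ , h₂ ⟩ ≈ (g ∘ π₂) ∘ ⟨ h₁ , h₂ ⟩
      fork h₁ h₂ eq = begin
        (f ∘ π₁) ∘ ⟨ h₁ , h₂ ⟩  ≈⟨ assoc f π₁ _ ⟩
        f ∘ (π₁ ∘ ⟨ h₁ , h₂ ⟩)  ≈⟨ ∘-congˡ (π₁∘⟨⟩ h₁ h₂) ⟩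
        f ∘ h₁                  ≈⟨ eq ⟩
        g ∘ h₂                  ≈⟨ ∘-congˡ (π₂∘⟨⟩ h₁ h₂) ⟨
        g ∘ (π₂ ∘ ⟨ h₁ , h₂ ⟩)  ≈⟨ assoc g π₂ _ ⟨
        (g ∘ π₂) ∘ ⟨ h₁ , h₂ ⟩  ∎

    pb₂-mono : Mono f → Mono pb₂
    pb₂-mono f-mono u v eq = unique u v
      (f-mono _ _ (begin
        f ∘ (pb₁ ∘ u)  ≈⟨ assoc f pb₁ u ⟨
        (f ∘ pb₁) ∘ u  ≈⟨ ∘-congʳ commute ⟩
        (g ∘ pb₂) ∘ u  ≈⟨ assoc g pb₂ u ⟩
        g ∘ (pb₂ ∘ u)  ≈⟨ ∘-congˡ eq ⟩
        g ∘ (pb₂ ∘ v)  ≈⟨ assoc g pb₂ v ⟨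
        (g ∘ pb₂) ∘ v  ≈⟨ ∘-congʳ commute ⟨
        (f ∘ pb₁) ∘ v  ≈⟨ assoc f pb₁ v ⟩
        f ∘ (pb₁ ∘ v)  ∎)) eq
      where
      open IsPullback pb-isPullback
      open module R {A} {B} = SetoidReasoning (hom-setoid A B)

record Topos {o ℓ e} (𝒞 : Category o ℓ e) : Set (o ⊔ ℓ ⊔ e) where
  open Category 𝒞
  field
    finitelyComplete : FinitelyComplete 𝒞
  open FinitelyComplete finitelyComplete public
  field
    𝒫₀         : Obj → Obj
    E          : Obj → Obj
    ∈ᴾ         : ∀ X → E X ⇒ X ×ᵒ 𝒫₀ X
    ∈ᴾ-mono    : ∀ X → Mono (∈ᴾ X)
    ξ          : ∀ {X Y R} (m : R ⇒ X ×ᵒ Y) → Mono m → Y ⇒ 𝒫₀ X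
    ξ-pullback : ∀ {X Y R} (m : R ⇒ X ×ᵒ Y) (m-mono : Mono m) →
                 m IsPullbackOf ∈ᴾ X Along (id ⁂ ξ m m-mono)
    ξ-unique   : ∀ {X Y R} (m : R ⇒ X ×ᵒ Y) (m-mono : Mono m) (g : Y ⇒ 𝒫₀ X) →
                 m IsPullbackOf ∈ᴾ X Along (id ⁂ g) → g ≈ ξ m m-mono

module ToposTheory {o ℓ e} {𝒞 : Category o ℓ e} (𝒯 : Topos 𝒞) where
  open Category 𝒞
  open Topos 𝒯

  private
    open module R {A} {B} = SetoidReasoning (hom-setoid A B)

  U : ∀ {X Y} → Y ⇒ 𝒫₀ X → Obj
  U {X} f = Pb (∈ᴾ X) (id ⁂ f)

  m⟨_⟩ : ∀ {X Y} (f : Y ⇒ 𝒫₀ X) → U f ⇒ X ×ᵒ Y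
  m⟨_⟩ {X} f = pb₂ (∈ᴾ X) (id ⁂ f)

  m⟨⟩-mono : ∀ {X Y} (f : Y ⇒ 𝒫₀ X) → Mono m⟨ f ⟩
  m⟨⟩-mono {X} f = pb₂-mono (∈ᴾ X) (id ⁂ f) (∈ᴾ-mono X)

  ξ-m⟨⟩ : ∀ {X Y} (f : Y ⇒ 𝒫₀ X) → f ≈ ξ m⟨ f ⟩ (m⟨⟩-mono f)
  ξ-m⟨⟩ {X} f = ξ-unique m⟨ f ⟩ (m⟨⟩-mono f) f (_ , pb-isPullback (∈ᴾ X) (id ⁂ f))

  FactorsThrough : ∀ {T A B} → T ⇒ B → A ⇒ B → Set (ℓ ⊔ e)
  FactorsThrough {T} {A} t m = Σ[ u ∈ T ⇒ A ] (m ∘ u ≈ t)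

  -- x ∈ᵗ y: the generalised element x belongs to the generalised subset y.
  _∈ᵗ_ : ∀ {T X} → T ⇒ X → T ⇒ 𝒫₀ X → Set (ℓ ⊔ e)
  _∈ᵗ_ {X = X} x y = FactorsThrough ⟨ x , y ⟩ (∈ᴾ X)

  ⟨⟩-cong : ∀ {T A B} {f f′ : T ⇒ A} {g g′ : T ⇒ B} → f ≈ f′ → g ≈ g′ → ⟨ f , g ⟩ ≈ ⟨ f′ , g′ ⟩
  ⟨⟩-cong p q = ×-unique _ _
    (Hom.trans (π₁∘⟨⟩ _ _) (Hom.trans p (Hom.sym (π₁∘⟨⟩ _ _))))
    (Hom.trans (π₂∘⟨⟩ _ _) (Hom.trans q (Hom.sym (π₂∘⟨⟩ _ _))))

  ⟨⟩∘ : ∀ {S T A B} (f : T ⇒ A) (g : T ⇒ B) (h : S ⇒ T) → ⟨ f , g ⟩ ∘ h ≈ ⟨ f ∘ h , g ∘ h ⟩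
  ⟨⟩∘ f g h = ×-unique _ _
    (Hom.trans (Hom.sym (assoc _ _ _)) (Hom.trans (∘-congʳ (π₁∘⟨⟩ f g)) (Hom.sym (π₁∘⟨⟩ _ _))))
    (Hom.trans (Hom.sym (assoc _ _ _)) (Hom.trans (∘-congʳ (π₂∘⟨⟩ f g)) (Hom.sym (π₂∘⟨⟩ _ _))))

  ⟨⟩-η : ∀ {T A B} (t : T ⇒ A ×ᵒ B) → ⟨ π₁ ∘ t , π₂ ∘ t ⟩ ≈ t
  ⟨⟩-η t = ×-unique _ _ (π₁∘⟨⟩ _ _) (π₂∘⟨⟩ _ _)

  ⁂∘⟨⟩ : ∀ {T A B A′ B′} (f : A ⇒ A′) (g : B ⇒ B′) (x : T ⇒ A) (y : T ⇒ B) →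
         (f ⁂ g) ∘ ⟨ x , y ⟩ ≈ ⟨ f ∘ x , g ∘ y ⟩
  ⁂∘⟨⟩ f g x y = Hom.trans (⟨⟩∘ _ _ _) (⟨⟩-cong
    (Hom.trans (assoc _ _ _) (∘-congˡ (π₁∘⟨⟩ x y)))
    (Hom.trans (assoc _ _ _) (∘-congˡ (π₂∘⟨⟩ x y))))

  id⁂∘ : ∀ {T A B B′} (g : B ⇒ B′) (t : T ⇒ A ×ᵒ B) → (id ⁂ g) ∘ t ≈ ⟨ π₁ ∘ t , g ∘ (π₂ ∘ t) ⟩
  id⁂∘ g t = Hom.trans (∘-congˡ (Hom.sym (⟨⟩-η t)))
    (Hom.trans (⁂∘⟨⟩ id g _ _) (⟨⟩-cong (identityˡ _) Hom.refl))

  factors-resp : ∀ {T A B} {t t′ : T ⇒ B} {m : A ⇒ B} → t ≈ t′ →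
                 FactorsThrough t m → FactorsThrough t′ m
  factors-resp t≈t′ (u , eq) = u , Hom.trans eq t≈t′

  pullback-factors : ∀ {R S A B T} {m : R ⇒ A} {n : S ⇒ B} {g : A ⇒ B} →
                     m IsPullbackOf n Along g → (t : T ⇒ A) →
                     FactorsThrough t m ⇔ FactorsThrough (g ∘ t) n
  pullback-factors {m = m} {n} {g} (s , isPb) t = mk⇔
    (λ (u , eq) → s ∘ u , (begin
      n ∘ (s ∘ u)  ≈⟨ assoc n s u ⟨
      (n ∘ s) ∘ u  ≈⟨ ∘-congʳ commute ⟩
      (g ∘ m) ∘ u  ≈⟨ assoc g m u ⟩
      g ∘ (m ∘ u)  ≈⟨ ∘-congˡ eq ⟩
      g ∘ t        ∎))
    (λ (u , eq) → universal u t eq , p₂∘universal u t eq)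
    where open IsPullback isPb

  ξ-∈ : ∀ {T X Y R} (m : R ⇒ X ×ᵒ Y) (m-mono : Mono m) (x : T ⇒ X) (y : T ⇒ Y) →
        FactorsThrough ⟨ x , y ⟩ m ⇔ (x ∈ᵗ (ξ m m-mono ∘ y))
  ξ-∈ m m-mono x y = mk⇔
    (λ p → factors-resp eq (to p))
    (λ p → from (factors-resp (Hom.sym eq) p))
    where
    open Equivalence (pullback-factors (ξ-pullback m m-mono) ⟨ x , y ⟩)
    eq : (id ⁂ ξ m m-mono) ∘ ⟨ x , y ⟩ ≈ ⟨ x , ξ m m-mono ∘ y ⟩
    eq = Hom.trans (⁂∘⟨⟩ _ _ x y) (⟨⟩-cong (identityˡ x) Hom.refl)

  𝒫-ext : ∀ {X Y} (g h : Y ⇒ 𝒫₀ X) →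
          (∀ {T} (x : T ⇒ X) (y : T ⇒ Y) → (x ∈ᵗ (g ∘ y)) ⇔ (x ∈ᵗ (h ∘ y))) → g ≈ h
  𝒫-ext {X} g h ext = Hom.trans (ξ-m⟨⟩ g) (Hom.sym (ξ-unique m⟨ g ⟩ (m⟨⟩-mono g) h (s , isPb)))
    where
    module G {T} (t : T ⇒ _) =
      Equivalence (pullback-factors (_ , pb-isPullback (∈ᴾ X) (id ⁂ g)) t)
    module X {T} (t : T ⇒ _) = Equivalence (ext (π₁ ∘ t) (π₂ ∘ t))

    fwd : FactorsThrough ((id ⁂ h) ∘ m⟨ g ⟩) (∈ᴾ X)
    fwd = factors-resp (Hom.sym (id⁂∘ h _))
      (X.to _ (factors-resp (id⁂∘ g _) (G.to m⟨ g ⟩ (id , identityʳ _))))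

    s : U g ⇒ E X
    s = proj₁ fwd

    bwd : ∀ {T} (k : T ⇒ E X) (t : T ⇒ _) → ∈ᴾ X ∘ k ≈ (id ⁂ h) ∘ t → FactorsThrough t m⟨ g ⟩
    bwd k t eq = G.from t (factors-resp (Hom.sym (id⁂∘ g t))
      (X.from t (factors-resp (id⁂∘ h t) (k , eq))))

    isPb : IsPullback s m⟨ g ⟩ (∈ᴾ X) (id ⁂ h)
    isPb = record
      { commute      = proj₂ fwd
      ; universal    = λ k t eq → proj₁ (bwd k t eq)
      ; p₁∘universal = λ k t eq → ∈ᴾ-mono X _ _ (begin
          ∈ᴾ X ∘ (s ∘ proj₁ (bwd k t eq))             ≈⟨ assoc _ _ _ ⟨
          (∈ᴾ X ∘ s) ∘ proj₁ (bwd k t eq)             ≈⟨ ∘-congʳ (proj₂ fwd) ⟩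
          ((id ⁂ h) ∘ m⟨ g ⟩) ∘ proj₁ (bwd k t eq)   ≈⟨ assoc _ _ _ ⟩
          (id ⁂ h) ∘ (m⟨ g ⟩ ∘ proj₁ (bwd k t eq))   ≈⟨ ∘-congˡ (proj₂ (bwd k t eq)) ⟩
          (id ⁂ h) ∘ t                               ≈⟨ eq ⟨
          ∈ᴾ X ∘ k                                    ∎)
      ; p₂∘universal = λ k t eq → proj₂ (bwd k t eq)
      ; unique       = λ u v _ eq → m⟨⟩-mono g u v eq
      }

  id-mono : ∀ {A} → Mono (id {A})
  id-mono u v eq = Hom.trans (Hom.sym (identityˡ u)) (Hom.trans eq (identityˡ v))

  total : ∀ {X Y} → Y ⇒ 𝒫₀ X
  total {X} {Y} = ξ (id {X ×ᵒ Y}) id-mono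

  ∈-total : ∀ {T X Y} (x : T ⇒ X) (y : T ⇒ Y) → x ∈ᵗ (total ∘ y)
  ∈-total x y = Equivalence.to (ξ-∈ id id-mono x y) (⟨ x , y ⟩ , identityˡ _)

  total-ext : ∀ {X Y} (g : Y ⇒ 𝒫₀ X) {S} (y : S ⇒ Y) →
              (∀ {T} (x : T ⇒ X) (z : T ⇒ S) → x ∈ᵗ (g ∘ (y ∘ z))) → g ∘ y ≈ total ∘ y
  total-ext g y all = 𝒫-ext _ _ (λ x z → mk⇔
    (λ _ → factors-resp (⟨⟩-cong Hom.refl (Hom.sym (assoc _ _ _))) (∈-total x (y ∘ z)))
    (λ _ → factors-resp (⟨⟩-cong Hom.refl (Hom.sym (assoc _ _ _))) (all x z)))

  -- The image of f is the intersection of all subobjects of B through which f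
  -- factors: K is the object of these, and Im consists of the elements of B
  -- lying in every member of K.
  module Image {A B} (f : A ⇒ B) where
    preimage : 𝒫₀ B ⇒ 𝒫₀ A
    preimage = ξ (pb₂ (∈ᴾ B) (f ⁂ id)) (pb₂-mono (∈ᴾ B) (f ⁂ id) (∈ᴾ-mono B))

    ∈-preimage : ∀ {T} (a : T ⇒ A) (y : T ⇒ 𝒫₀ B) → ((f ∘ a) ∈ᵗ y) ⇔ (a ∈ᵗ (preimage ∘ y))
    ∈-preimage a y = mk⇔
      (λ p → M.to (N.from (factors-resp (Hom.sym eq) p)))
      (λ p → factors-resp eq (N.to (M.from p)))
      where
      module M = Equivalence
        (ξ-∈ (pb₂ (∈ᴾ B) (f ⁂ id)) (pb₂-mono (∈ᴾ B) (f ⁂ id) (∈ᴾ-mono B)) a y)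
      module N = Equivalence
        (pullback-factors (_ , pb-isPullback (∈ᴾ B) (f ⁂ id)) ⟨ a , y ⟩)
      eq : (f ⁂ id) ∘ ⟨ a , y ⟩ ≈ ⟨ f ∘ a , y ⟩
      eq = Hom.trans (⁂∘⟨⟩ f id a y) (⟨⟩-cong Hom.refl (identityˡ y))

    K : Obj
    K = Eq preimage total

    k : K ⇒ 𝒫₀ B
    k = equ preimage total

    f-∈-k : ∀ {T} (a : T ⇒ A) (κ : T ⇒ K) → (f ∘ a) ∈ᵗ (k ∘ κ)
    f-∈-k a κ = Equivalence.from (∈-preimage a (k ∘ κ))
      (factors-resp (⟨⟩-cong Hom.refl eq) (∈-total a (k ∘ κ)))
      where
      eq : total ∘ (k ∘ κ) ≈ preimage ∘ (k ∘ κ)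
      eq = Hom.trans (Hom.sym (assoc _ _ _))
        (Hom.trans (∘-congʳ (Hom.sym (equ-commute preimage total))) (assoc _ _ _))

    swap : K ×ᵒ B ⇒ B ×ᵒ 𝒫₀ B
    swap = ⟨ π₂ , k ∘ π₁ ⟩

    containing : B ⇒ 𝒫₀ K
    containing = ξ (pb₂ (∈ᴾ B) swap) (pb₂-mono (∈ᴾ B) swap (∈ᴾ-mono B))

    ∈-containing : ∀ {T} (κ : T ⇒ K) (b : T ⇒ B) → (b ∈ᵗ (k ∘ κ)) ⇔ (κ ∈ᵗ (containing ∘ b))
    ∈-containing κ b = mk⇔
      (λ p → M.to (N.from (factors-resp (Hom.sym eq) p)))
      (λ p → factors-resp eq (N.to (M.from p)))
      where
      module M = Equivalence (ξ-∈ (pb₂ (∈ᴾ B) swap) (pb₂-mono (∈ᴾ B) swap (∈ᴾ-mono B)) κ b)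
      module N = Equivalence (pullback-factors (_ , pb-isPullback (∈ᴾ B) swap) ⟨ κ , b ⟩)
      eq : swap ∘ ⟨ κ , b ⟩ ≈ ⟨ b , k ∘ κ ⟩
      eq = Hom.trans (⟨⟩∘ _ _ _)
        (⟨⟩-cong (π₂∘⟨⟩ _ _) (Hom.trans (assoc _ _ _) (∘-congˡ (π₁∘⟨⟩ _ _))))

    Im : Obj
    Im = Eq containing total

    im : Im ⇒ B
    im = equ containing total

    f-fork : containing ∘ f ≈ total ∘ f
    f-fork = total-ext containing f (λ κ a → Equivalence.to (∈-containing κ (f ∘ a)) (f-∈-k a κ))

    coim : A ⇒ Im
    coim = equ-lift containing total f f-fork

    im∘coim : im ∘ coim ≈ f
    im∘coim = equ∘lift containing total f f-fork

    im-least : ∀ {S} (m : S ⇒ B) → Mono m → FactorsThrough f m → FactorsThrough im m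
    im-least {S} m m-mono (f′ , m∘f′≈f) = proj₁ through , (begin
        m ∘ proj₁ through            ≈⟨ ∘-congʳ (π₁∘⟨⟩ m !) ⟨
        (π₁ ∘ m!) ∘ proj₁ through    ≈⟨ assoc _ _ _ ⟩
        π₁ ∘ (m! ∘ proj₁ through)    ≈⟨ ∘-congˡ (proj₂ through) ⟩
        π₁ ∘ ⟨ im , ! ⟩              ≈⟨ π₁∘⟨⟩ im ! ⟩
        im                           ∎)
      where
      m! : S ⇒ B ×ᵒ ⊤ᵒ
      m! = ⟨ m , ! ⟩

      m!-mono : Mono m!
      m!-mono u v eq = m-mono u v (begin
        m ∘ u          ≈⟨ ∘-congʳ (π₁∘⟨⟩ m !) ⟨
        (π₁ ∘ m!) ∘ u  ≈⟨ assoc _ _ _ ⟩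
        π₁ ∘ (m! ∘ u)  ≈⟨ ∘-congˡ eq ⟩
        π₁ ∘ (m! ∘ v)  ≈⟨ assoc _ _ _ ⟨
        (π₁ ∘ m!) ∘ v  ≈⟨ ∘-congʳ (π₁∘⟨⟩ m !) ⟩
        m ∘ v          ∎)

      name : ⊤ᵒ ⇒ 𝒫₀ B
      name = ξ m! m!-mono

      name-fork : preimage ∘ name ≈ total ∘ name
      name-fork = total-ext preimage name (λ a z →
        Equivalence.to (∈-preimage a (name ∘ z))
          (Equivalence.to (ξ-∈ m! m!-mono (f ∘ a) z)
            (f′ ∘ a , Hom.trans (⟨⟩∘ m ! _) (⟨⟩-cong
              (Hom.trans (Hom.sym (assoc _ _ _)) (∘-congʳ m∘f′≈f)) (!-unique _ _)))))

      κ : ⊤ᵒ ⇒ K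
      κ = equ-lift preimage total name name-fork

      im-∈-k : im ∈ᵗ (k ∘ (κ ∘ !))
      im-∈-k = Equivalence.from (∈-containing (κ ∘ !) im)
        (factors-resp (⟨⟩-cong Hom.refl (Hom.sym (equ-commute containing total)))
          (∈-total (κ ∘ !) im))

      through : FactorsThrough ⟨ im , ! ⟩ m!
      through = Equivalence.from (ξ-∈ m! m!-mono im !)
        (factors-resp (⟨⟩-cong Hom.refl
          (Hom.trans (Hom.sym (assoc _ _ _)) (∘-congʳ (equ∘lift preimage total name name-fork))))
          im-∈-k)

    coim-epi : Epi coim
    coim-epi u v eq = begin
        u                  ≈⟨ identityʳ u ⟨
        u ∘ id             ≈⟨ ∘-congˡ d∘s≈id ⟨
        u ∘ (d ∘ s)        ≈⟨ assoc _ _ _ ⟨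
        (u ∘ d) ∘ s        ≈⟨ ∘-congʳ (equ-commute u v) ⟩
        (v ∘ d) ∘ s        ≈⟨ assoc _ _ _ ⟩
        v ∘ (d ∘ s)        ≈⟨ ∘-congˡ d∘s≈id ⟩
        v ∘ id             ≈⟨ identityʳ v ⟩
        v                  ∎
      where
      d : Eq u v ⇒ Im
      d = equ u v

      split : FactorsThrough im (im ∘ d)
      split = im-least (im ∘ d)
        (λ x y eq′ → equ-mono u v x y (equ-mono containing total _ _
          (Hom.trans (Hom.sym (assoc _ _ _)) (Hom.trans eq′ (assoc _ _ _)))))
        (equ-lift u v coim eq ,
          Hom.trans (assoc _ _ _) (Hom.trans (∘-congˡ (equ∘lift u v coim eq)) im∘coim))

      s : Im ⇒ Eq u v
      s = proj₁ split

      d∘s≈id : d ∘ s ≈ id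
      d∘s≈id = equ-mono containing total _ _
        (Hom.trans (Hom.sym (assoc _ _ _)) (Hom.trans (proj₂ split) (Hom.sym (identityʳ im))))

  epiMono : ∀ {A B} (f : A ⇒ B) → EpiMonoFactorisation f
  epiMono f = record
    { epi       = coim
    ; mono      = im
    ; isEpi     = coim-epi
    ; isMono    = equ-mono containing total
    ; factorise = im∘coim
    }
    where open Image f

  𝒫₁ : ∀ {X Y} → X ⇒ Y → 𝒫₀ X ⇒ 𝒫₀ Y
  𝒫₁ {X} f = ξ mono isMono
    where open EpiMonoFactorisation (epiMono ((f ⁂ id) ∘ ∈ᴾ X))

  diagonal-mono : ∀ {X} → Mono ⟨ id {X} , id ⟩
  diagonal-mono u v eq = begin
    u                      ≈⟨ identityˡ u ⟨
    id ∘ u                 ≈⟨ ∘-congʳ (π₁∘⟨⟩ id id) ⟨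
    (π₁ ∘ ⟨ id , id ⟩) ∘ u ≈⟨ assoc _ _ _ ⟩
    π₁ ∘ (⟨ id , id ⟩ ∘ u) ≈⟨ ∘-congˡ eq ⟩
    π₁ ∘ (⟨ id , id ⟩ ∘ v) ≈⟨ assoc _ _ _ ⟨
    (π₁ ∘ ⟨ id , id ⟩) ∘ v ≈⟨ ∘-congʳ (π₁∘⟨⟩ id id) ⟩
    id ∘ v                 ≈⟨ identityˡ v ⟩
    v                      ∎

  η : ∀ X → X ⇒ 𝒫₀ X
  η X = ξ ⟨ id , id ⟩ diagonal-mono

-- [ Y ] α ≤ β is the preorder on the Hom-set of X and F₀ Y; it is indexed by Y
-- because Y cannot be recovered from F₀ Y.
record GoodOrder {o ℓ e} {𝒞 : Category o ℓ e} (F : Endofunctor 𝒞) (p : Level)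
       : Set (o ⊔ ℓ ⊔ e ⊔ suc p) where
  open Category 𝒞
  open Endofunctor F
  infix 4 [_]_≤_
  field
    [_]_≤_     : ∀ Y {X} → Rel (X ⇒ F₀ Y) p
    isPreorder : ∀ {X Y} → IsPreorder (_≈_ {X} {F₀ Y}) ([ Y ]_≤_)
    monotone   : ∀ {X′ X Y Y′} {α β : X ⇒ F₀ Y} (f : X′ ⇒ X) (g : Y ⇒ Y′) →
                 [ Y ] α ≤ β → [ Y′ ] F₁ g ∘ α ∘ f ≤ F₁ g ∘ β ∘ f
    lifting    : ∀ {X Y Z} (h : X ⇒ F₀ Z) (k : X ⇒ F₀ Y) (g : Y ⇒ Z) →
                 [ Z ] h ≤ F₁ g ∘ k →
                 Σ[ k′ ∈ X ⇒ F₀ Y ] ([ Y ] k′ ≤ k) × h ≈ F₁ g ∘ k′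

module Simulations {o ℓ e p} {𝒞 : Category o ℓ e} (𝒯 : Topos 𝒞)
                   (F : Endofunctor 𝒞) (≤ : GoodOrder F p) where
  open Category 𝒞
  open Topos 𝒯
  open ToposTheory 𝒯
  open Endofunctor F
  open GoodOrder ≤

  𝒫F₀ : Obj → Obj
  𝒫F₀ X = 𝒫₀ (F₀ X)

  𝒫F₁ : ∀ {X Y} → X ⇒ Y → 𝒫F₀ X ⇒ 𝒫F₀ Y
  𝒫F₁ f = 𝒫₁ (F₁ f)

  infix 4 [_]_≤𝒫_
  [_]_≤𝒫_ : ∀ Y {X} → Rel (X ⇒ 𝒫F₀ Y) (o ⊔ ℓ ⊔ e ⊔ p)
  [ Y ] f ≤𝒫 g =
    ∃[ Z ] Σ[ u ∈ Z ⇒ U g ] Σ[ q ∈ Z ⇒ U f ]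
      Epi q ×
      [ Y ] π₁ ∘ m⟨ f ⟩ ∘ q ≤ π₁ ∘ m⟨ g ⟩ ∘ u ×
      π₂ ∘ m⟨ f ⟩ ∘ q ≈ π₂ ∘ m⟨ g ⟩ ∘ u

  IsHomomorphism : ∀ {X Y} → X ⇒ 𝒫F₀ X → Y ⇒ 𝒫F₀ Y → X ⇒ Y → Set e
  IsHomomorphism α β f = 𝒫F₁ f ∘ α ≈ β ∘ f

  IsLaxHomomorphism : ∀ {X Y} → X ⇒ 𝒫F₀ X → Y ⇒ 𝒫F₀ Y → X ⇒ Y → Set (o ⊔ ℓ ⊔ e ⊔ p)
  IsLaxHomomorphism {Y = Y} α β f = [ Y ] 𝒫F₁ f ∘ α ≤𝒫 β ∘ f

  HasWitness : ∀ {X Y R} → X ⇒ F₀ X → Y ⇒ F₀ Y → R ⇒ X ×ᵒ Y → Set (o ⊔ ℓ ⊔ e ⊔ p)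
  HasWitness {X} {Y} {R} α β r = Σ[ W ∈ R ⇒ 𝒫F₀ R ]
    [ X ] η (F₀ X) ∘ α ∘ π₁ ∘ r ≤𝒫 𝒫F₁ π₁ ∘ 𝒫F₁ r ∘ W ×
    [ Y ] 𝒫F₁ π₂ ∘ 𝒫F₁ r ∘ W ≤𝒫 η (F₀ Y) ∘ β ∘ π₂ ∘ r

  -- The relation is the subobject represented by r, so the condition ranges
  -- over all monos representing it.
  RepresentsToposalAMSimulation : ∀ {X Y R} → X ⇒ F₀ X → Y ⇒ F₀ Y → R ⇒ X ×ᵒ Y →
                                  Set (o ⊔ ℓ ⊔ e ⊔ p)
  RepresentsToposalAMSimulation {X} {Y} α β r =
    ∀ {R′} (r′ : R′ ⇒ X ×ᵒ Y) → Mono r′ → SameSubobject r r′ → HasWitness α β r′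

{-# OPTIONS --safe #-}
module Submission where

-- In the internal language of the topos, a toposal AM-simulation on R with witness W
-- says: for all ρ, some t ∈ W ρ has α (π₁ (r ρ)) ≤ F (π₁ r) t, and every t ∈ W ρ has
-- F (π₂ r) t ≤ β (π₂ (r ρ)). For γ on a span, the first condition becomes
-- an equality that moreover holds for every element of γ. From W, the lifting condition of
-- a good order yields t′ ≤ t with α (π₁ (r ρ)) = F (π₁ r) t′, and γ collects
-- these t′. Conversely, R is the image of ⟨ f , g ⟩ and W is the union of γ along the epi
-- Z → R. Existential statements hold only after passing to an epi cover, so the argument
-- rests on the stability of epis under pullback.

open import Defs
open import Level using (_⊔_)
open import Data.Product using (Σ-syntax; ∃-syntax; _×_; _,_; proj₁; proj₂)
open import Function.Bundles using (_⇔_; mk⇔; Equivalence)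
open import Relation.Binary.Structures using (IsPreorder)
import Relation.Binary.Reasoning.Setoid as SetoidReasoning

module KripkeJoyal {o ℓ e} {𝒞 : Category o ℓ e} (𝒯 : Topos 𝒞) where
  open Category 𝒞
  open Topos 𝒯
  open ToposTheory 𝒯

  private
    open module R {A} {B} = SetoidReasoning (hom-setoid A B)

  -- Pairings, monos and epis.

  pullˡ : ∀ {A B C D} {g : C ⇒ D} {f : B ⇒ C} {k : B ⇒ D} {h : A ⇒ B} →
          g ∘ f ≈ k → g ∘ (f ∘ h) ≈ k ∘ h
  pullˡ eq = Hom.trans (Hom.sym (assoc _ _ _)) (∘-congʳ eq)

  ⟨⟩-inj₁ : ∀ {T A B} {x x′ : T ⇒ A} {y y′ : T ⇒ B} → ⟨ x , y ⟩ ≈ ⟨ x′ , y′ ⟩ → x ≈ x′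
  ⟨⟩-inj₁ eq = Hom.trans (Hom.sym (π₁∘⟨⟩ _ _)) (Hom.trans (∘-congˡ eq) (π₁∘⟨⟩ _ _))

  ⟨⟩-inj₂ : ∀ {T A B} {x x′ : T ⇒ A} {y y′ : T ⇒ B} → ⟨ x , y ⟩ ≈ ⟨ x′ , y′ ⟩ → y ≈ y′
  ⟨⟩-inj₂ eq = Hom.trans (Hom.sym (π₂∘⟨⟩ _ _)) (Hom.trans (∘-congˡ eq) (π₂∘⟨⟩ _ _))

  mono-∘ : ∀ {A B C} {m : B ⇒ C} {n : A ⇒ B} → Mono m → Mono n → Mono (m ∘ n)
  mono-∘ m-mono n-mono u v eq = n-mono u v (m-mono _ _
    (Hom.trans (Hom.sym (assoc _ _ _)) (Hom.trans eq (assoc _ _ _))))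

  mono-⟨⟩ʳ : ∀ {A B C} {f : A ⇒ B} {m : A ⇒ C} → Mono m → Mono ⟨ f , m ⟩
  mono-⟨⟩ʳ m-mono u v eq = m-mono u v
    (⟨⟩-inj₂ (Hom.trans (Hom.sym (⟨⟩∘ _ _ u)) (Hom.trans eq (⟨⟩∘ _ _ v))))

  mono-⟨⟩ˡ : ∀ {A B C} {m : A ⇒ B} {f : A ⇒ C} → Mono m → Mono ⟨ m , f ⟩
  mono-⟨⟩ˡ m-mono u v eq = m-mono u v
    (⟨⟩-inj₁ (Hom.trans (Hom.sym (⟨⟩∘ _ _ u)) (Hom.trans eq (⟨⟩∘ _ _ v))))

  epi-id : ∀ {A} → Epi (id {A})
  epi-id u v eq = Hom.trans (Hom.sym (identityʳ u)) (Hom.trans eq (identityʳ v))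

  epi-∘ : ∀ {A B C} {p : B ⇒ C} {q : A ⇒ B} → Epi p → Epi q → Epi (p ∘ q)
  epi-∘ p-epi q-epi u v eq = p-epi u v (q-epi _ _
    (Hom.trans (assoc _ _ _) (Hom.trans eq (Hom.sym (assoc _ _ _)))))

  iso-epi : ∀ {A B} (i : A ≅ B) → Epi (_≅_.to i)
  iso-epi i u v eq = begin
    u                ≈⟨ identityʳ u ⟨
    u ∘ id           ≈⟨ ∘-congˡ to∘from ⟨
    u ∘ (to ∘ from)  ≈⟨ pullˡ eq ⟩
    (v ∘ to) ∘ from  ≈⟨ assoc _ _ _ ⟩
    v ∘ (to ∘ from)  ≈⟨ ∘-congˡ to∘from ⟩
    v ∘ id           ≈⟨ identityʳ v ⟩
    v                ∎
    where open _≅_ i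

  -- Descent along epis and stability of epis under pullback.

  -- The characteristic map of `m` agrees with `total` after the epi `q`, hence agrees with it
  -- outright, so the generic point of `T` belongs to `m`.
  epi-through-mono : ∀ {A S T} {q : A ⇒ T} {m : S ⇒ T} → Epi q → Mono m →
                     FactorsThrough q m → FactorsThrough id m
  epi-through-mono {q = q} {m} q-epi m-mono (f , m∘f≈q) = proj₁ section ,
    ⟨⟩-inj₂ (Hom.trans (Hom.sym (⟨⟩∘ ! m _)) (proj₂ section))
    where
    -- Paired with `!`, the subobject `m` is named by a morphism from `T` into the power-object of
    -- `⊤ᵒ`, which acts as the subobject classifier.
    m! = mono-⟨⟩ʳ {f = !} m-mono

    χ≈total : ξ ⟨ ! , m ⟩ m! ≈ total
    χ≈total = q-epi _ _ (total-ext _ q (λ x z →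
      Equivalence.to (ξ-∈ _ m! x (q ∘ z))
        (f ∘ z , Hom.trans (⟨⟩∘ ! m _) (⟨⟩-cong (!-unique _ _) (pullˡ m∘f≈q)))))

    section : FactorsThrough ⟨ ! , id ⟩ ⟨ ! , m ⟩
    section = Equivalence.from (ξ-∈ _ m! ! id)
      (factors-resp (⟨⟩-cong Hom.refl (∘-congʳ (Hom.sym χ≈total))) (∈-total ! id))

  -- The epi `c` factors through the pullback of `m` along `t`. This pullback is a mono, so it has a
  -- section, and composing the section with the other projection gives the factorisation of `t`.
  factors-local : ∀ {A B S T} {m : A ⇒ B} {t : T ⇒ B} {c : S ⇒ T} → Mono m → Epi c →
                  FactorsThrough (t ∘ c) m → FactorsThrough t m
  factors-local {m = m} {t} {c} m-mono c-epi (u , eq) = pb₁ m t ∘ s , (begin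
      m ∘ (pb₁ m t ∘ s)  ≈⟨ pullˡ commute ⟩
      (t ∘ pb₂ m t) ∘ s  ≈⟨ assoc _ _ _ ⟩
      t ∘ (pb₂ m t ∘ s)  ≈⟨ ∘-congˡ (proj₂ section) ⟩
      t ∘ id             ≈⟨ identityʳ t ⟩
      t                  ∎)
    where
    open IsPullback (pb-isPullback m t)
    section = epi-through-mono c-epi (pb₂-mono m t m-mono)
      (universal u c eq , p₂∘universal u c eq)
    s = proj₁ section

  -- If u and v agree on the pullback of q, then for b in the image of q the
  -- fibre of g over b lies in the equaliser of u and v. As q is epi and the
  -- fibres are given by morphisms into a power-object, this holds for all b.
  epi-pullback : ∀ {A B T} (q : A ⇒ B) (g : T ⇒ B) → Epi q → Epi (pb₂ q g)
  epi-pullback {A} {B} {T} q g q-epi u v eq = begin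
      u              ≈⟨ identityʳ u ⟨
      u ∘ id         ≈⟨ ∘-congˡ id≈d∘s ⟩
      u ∘ (d ∘ s)    ≈⟨ pullˡ (equ-commute u v) ⟩
      (v ∘ d) ∘ s    ≈⟨ assoc _ _ _ ⟩
      v ∘ (d ∘ s)    ≈⟨ ∘-congˡ id≈d∘s ⟨
      v ∘ id         ≈⟨ identityʳ v ⟩
      v              ∎
    where
    open IsPullback (pb-isPullback q g)

    d : Eq u v ⇒ T
    d = equ u v

    graph : T ⇒ T ×ᵒ B
    graph = ⟨ id , g ⟩

    graph-mono : Mono graph
    graph-mono = mono-⟨⟩ˡ id-mono

    graph∘d-mono : Mono (graph ∘ d)
    graph∘d-mono = mono-∘ graph-mono (equ-mono u v)

    restrict : ∀ {S} (x : S ⇒ T) (y : S ⇒ A) → FactorsThrough ⟨ x , q ∘ y ⟩ graph →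
               FactorsThrough ⟨ x , q ∘ y ⟩ (graph ∘ d)
    restrict x y (w , eqw) = equ-lift u v w u∘w≈v∘w ,
        Hom.trans (assoc _ _ _) (Hom.trans (∘-congˡ (equ∘lift u v w u∘w≈v∘w)) eqw)
      where
      -- The point `w` lies over `q ∘ y`, so it lifts to the pullback, where `u` and `v` agree.
      over = universal y w (Hom.sym (⟨⟩-inj₂ (Hom.trans (Hom.sym (⟨⟩∘ id g w)) eqw)))
      pb₂∘over : pb₂ q g ∘ over ≈ w
      pb₂∘over = p₂∘universal y w _
      u∘w≈v∘w : u ∘ w ≈ v ∘ w
      u∘w≈v∘w = begin
        u ∘ w                 ≈⟨ ∘-congˡ pb₂∘over ⟨
        u ∘ (pb₂ q g ∘ over)  ≈⟨ pullˡ eq ⟩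
        (v ∘ pb₂ q g) ∘ over  ≈⟨ assoc _ _ _ ⟩
        v ∘ (pb₂ q g ∘ over)  ≈⟨ ∘-congˡ pb₂∘over ⟩
        v ∘ w                 ∎

    fibres : ξ graph graph-mono ≈ ξ (graph ∘ d) graph∘d-mono
    fibres = q-epi _ _ (𝒫-ext _ _ (λ x y →
      let module G = Equivalence (ξ-∈ graph graph-mono x (q ∘ y))
          module D = Equivalence (ξ-∈ (graph ∘ d) graph∘d-mono x (q ∘ y))
      in mk⇔
        (λ p → factors-resp (⟨⟩-cong Hom.refl (Hom.sym (assoc _ _ _)))
          (D.to (restrict x y (G.from (factors-resp (⟨⟩-cong Hom.refl (assoc _ _ _)) p)))))
        (λ p → let (w , eqw) = D.from (factors-resp (⟨⟩-cong Hom.refl (assoc _ _ _)) p) in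
          factors-resp (⟨⟩-cong Hom.refl (Hom.sym (assoc _ _ _)))
            (G.to (d ∘ w , Hom.trans (Hom.sym (assoc _ _ _)) eqw)))))

    -- Equality of the fibres, read at the generic point of `T`, makes the equaliser `d` split.
    section : FactorsThrough ⟨ id , g ⟩ (graph ∘ d)
    section = Equivalence.from (ξ-∈ _ graph∘d-mono id g)
      (factors-resp (⟨⟩-cong Hom.refl (∘-congʳ fibres))
        (Equivalence.to (ξ-∈ _ graph-mono id g) (id , identityʳ _)))

    s : T ⇒ Eq u v
    s = proj₁ section

    id≈d∘s : id ≈ d ∘ s
    id≈d∘s = graph-mono _ _ (begin
      graph ∘ id       ≈⟨ identityʳ _ ⟩
      graph            ≈⟨ proj₂ section ⟨
      (graph ∘ d) ∘ s  ≈⟨ assoc _ _ _ ⟩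
      graph ∘ (d ∘ s)  ∎)

  -- Existential statements over epi covers.

  -- Kripke–Joyal forcing of an existential statement.
  Locally : ∀ {a} T → (∀ {S} → S ⇒ T → Set a) → Set (o ⊔ ℓ ⊔ e ⊔ a)
  Locally T P = ∃[ S ] Σ[ c ∈ S ⇒ T ] Epi c × P c

  module _ {a b T} {P : ∀ {S} → S ⇒ T → Set a} {Q : ∀ {S} → S ⇒ T → Set b} where
    map : Locally T P → (∀ {S} (c : S ⇒ T) → P c → Q c) → Locally T Q
    map (S , c , c-epi , Pc) f = S , c , c-epi , f c Pc

    bind : Locally T P →
           (∀ {S} (c : S ⇒ T) → P c → Locally S (λ c′ → Q (c ∘ c′))) → Locally T Q
    bind (S , c , c-epi , Pc) f =
      let S′Qc = f c Pc in
      proj₁ S′Qc , c ∘ proj₁ (proj₂ S′Qc) ,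
      epi-∘ c-epi (proj₁ (proj₂ (proj₂ S′Qc))) , proj₂ (proj₂ (proj₂ S′Qc))

  pure : ∀ {a T} {P : ∀ {S} → S ⇒ T → Set a} → P id → Locally T P
  pure Pid = _ , id , epi-id , Pid

  ≈-local : ∀ {T X} {x y : T ⇒ X} → Locally T (λ c → x ∘ c ≈ y ∘ c) → x ≈ y
  ≈-local (_ , _ , c-epi , eq) = c-epi _ _ eq

  -- The cover is the pullback of `q` along `t`, and its other projection is the lift.
  epi-lifts : ∀ {A B T} {q : A ⇒ B} → Epi q → (t : T ⇒ B) →
              Locally T (λ c → FactorsThrough (t ∘ c) q)
  epi-lifts {q = q} q-epi t = _ , pb₂ q t , epi-pullback q t q-epi , pb₁ q t ,
    IsPullback.commute (pb-isPullback q t)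

  -- From left to right, a point of the image lifts locally along the epi part; from right to left,
  -- factoring through the mono part descends along the cover.
  image-factors : ∀ {A B T} {h : A ⇒ B} (M : EpiMonoFactorisation h) (t : T ⇒ B) →
                  FactorsThrough t (EpiMonoFactorisation.mono M) ⇔
                  Locally T (λ c → FactorsThrough (t ∘ c) h)
  image-factors {h = h} M t = mk⇔
    (λ (u , eq) → let (S , c , c-epi , a , eqa) = epi-lifts isEpi u in
      S , c , c-epi , a , (begin
        h ∘ a             ≈⟨ ∘-congʳ factorise ⟨
        (mono ∘ epi) ∘ a  ≈⟨ assoc _ _ _ ⟩
        mono ∘ (epi ∘ a)  ≈⟨ ∘-congˡ eqa ⟩
        mono ∘ (u ∘ c)    ≈⟨ pullˡ eq ⟩
        t ∘ c             ∎))
    (λ (S , c , c-epi , a , eqa) → factors-local isMono c-epi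
      (epi ∘ a , Hom.trans (pullˡ factorise) eqa))
    where open EpiMonoFactorisation M

  -- Membership: singletons, images and direct images.

  ∈-resp : ∀ {T X} {x x′ : T ⇒ X} {y y′ : T ⇒ 𝒫₀ X} → x ≈ x′ → y ≈ y′ → x ∈ᵗ y → x′ ∈ᵗ y′
  ∈-resp p q = factors-resp (⟨⟩-cong p q)

  ∈-∘ : ∀ {S T X} {x : T ⇒ X} {y : T ⇒ 𝒫₀ X} (s : S ⇒ T) → x ∈ᵗ y → (x ∘ s) ∈ᵗ (y ∘ s)
  ∈-∘ s (u , eq) = u ∘ s , Hom.trans (pullˡ eq) (⟨⟩∘ _ _ s)

  ∈-m⟨⟩ : ∀ {T X Y} (f : Y ⇒ 𝒫₀ X) (x : T ⇒ X) (y : T ⇒ Y) →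
          FactorsThrough ⟨ x , y ⟩ m⟨ f ⟩ ⇔ (x ∈ᵗ (f ∘ y))
  ∈-m⟨⟩ f x y = mk⇔
    (λ p → factors-resp eq (to p))
    (λ p → from (factors-resp (Hom.sym eq) p))
    where
    open Equivalence (pullback-factors (_ , pb-isPullback (∈ᴾ _) (id ⁂ f)) ⟨ x , y ⟩)
    eq : (id ⁂ f) ∘ ⟨ x , y ⟩ ≈ ⟨ x , f ∘ y ⟩
    eq = Hom.trans (⁂∘⟨⟩ _ _ x y) (⟨⟩-cong (identityˡ x) Hom.refl)

  m⟨⟩-∈ : ∀ {S X Y} (f : Y ⇒ 𝒫₀ X) (u : S ⇒ U f) →
          (π₁ ∘ m⟨ f ⟩ ∘ u) ∈ᵗ (f ∘ (π₂ ∘ m⟨ f ⟩ ∘ u))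
  m⟨⟩-∈ f u = Equivalence.to (∈-m⟨⟩ f _ _) (u , Hom.sym (⟨⟩-η _))

  -- Characterising `n` by its elements covers both bracketings of a composite of `η X` with two
  -- morphisms.
  record IsSingleton {X Y} (a : Y ⇒ X) (n : Y ⇒ 𝒫₀ X) : Set (o ⊔ ℓ ⊔ e) where
    field
      ∈-singleton : ∀ {T} (x : T ⇒ X) (y : T ⇒ Y) → (x ∈ᵗ (n ∘ y)) ⇔ x ≈ a ∘ y

    to : ∀ {T} {x : T ⇒ X} {y : T ⇒ Y} → x ∈ᵗ (n ∘ y) → x ≈ a ∘ y
    to = Equivalence.to (∈-singleton _ _)

    from : ∀ {T} {x : T ⇒ X} {y : T ⇒ Y} → x ≈ a ∘ y → x ∈ᵗ (n ∘ y)
    from = Equivalence.from (∈-singleton _ _)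

  η-singleton : ∀ {X Y} {a : Y ⇒ X} → IsSingleton a (η X ∘ a)
  η-singleton {X} {a = a} = record { ∈-singleton = λ x y →
    let module Ξ = Equivalence (ξ-∈ ⟨ id , id ⟩ diagonal-mono x (a ∘ y))
    in mk⇔
      (λ p → let v = Ξ.from (∈-resp Hom.refl (assoc (η X) a y) p)
                 eq = Hom.trans (Hom.sym (⟨⟩∘ id id (proj₁ v))) (proj₂ v) in
        Hom.trans (Hom.sym (⟨⟩-inj₁ eq)) (⟨⟩-inj₂ eq))
      (λ eq → ∈-resp Hom.refl (Hom.sym (assoc (η X) a y)) (Ξ.to (x ,
        Hom.trans (⟨⟩∘ id id x) (⟨⟩-cong (identityˡ x) (Hom.trans (identityˡ x) eq))))) }

  -- In the internal language, `m y` is the set of all `h a` with `k a = y`.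
  record IsImage {A X Y} (h : A ⇒ X) (k : A ⇒ Y) (m : Y ⇒ 𝒫₀ X) : Set (o ⊔ ℓ ⊔ e) where
    field
      ∈-image : ∀ {T} (x : T ⇒ X) (y : T ⇒ Y) → (x ∈ᵗ (m ∘ y)) ⇔
                Locally T (λ {S} c → Σ[ a ∈ S ⇒ A ] h ∘ a ≈ x ∘ c × k ∘ a ≈ y ∘ c)

    to : ∀ {T} {x : T ⇒ X} {y : T ⇒ Y} → x ∈ᵗ (m ∘ y) →
         Locally T (λ {S} c → Σ[ a ∈ S ⇒ A ] h ∘ a ≈ x ∘ c × k ∘ a ≈ y ∘ c)
    to = Equivalence.to (∈-image _ _)

    contains : ∀ {T} (a : T ⇒ A) → (h ∘ a) ∈ᵗ (m ∘ (k ∘ a))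
    contains a = Equivalence.from (∈-image _ _)
      (pure (a , Hom.sym (identityʳ _) , Hom.sym (identityʳ _)))

  -- The common core of `image` and `𝒫₁`, both of which name the mono part of an epi-mono
  -- factorisation.
  ξ-image-∈ : ∀ {A X Y} {h : A ⇒ X ×ᵒ Y} (M : EpiMonoFactorisation h) →
              let open EpiMonoFactorisation M in
              ∀ {T} (x : T ⇒ X) (y : T ⇒ Y) → (x ∈ᵗ (ξ mono isMono ∘ y)) ⇔
              Locally T (λ {S} c → Σ[ a ∈ S ⇒ A ] h ∘ a ≈ ⟨ x ∘ c , y ∘ c ⟩)
  ξ-image-∈ {A} {h = h} M {T} x y = mk⇔ to from
    where
    open EpiMonoFactorisation M
    module Ξ = Equivalence (ξ-∈ mono isMono x y)
    module I = Equivalence (image-factors M ⟨ x , y ⟩)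

    Lifts = Locally T (λ {S} c → Σ[ a ∈ S ⇒ A ] h ∘ a ≈ ⟨ x ∘ c , y ∘ c ⟩)

    to : x ∈ᵗ (ξ mono isMono ∘ y) → Lifts
    to p = map (I.to (Ξ.from p)) λ c (a , eq) → a , Hom.trans eq (⟨⟩∘ x y c)

    from : Lifts → x ∈ᵗ (ξ mono isMono ∘ y)
    from p = Ξ.to (I.from (map p λ c (a , eq) → a , Hom.trans eq (Hom.sym (⟨⟩∘ x y c))))

  image : ∀ {A X Y} (h : A ⇒ X) (k : A ⇒ Y) → Σ[ m ∈ Y ⇒ 𝒫₀ X ] IsImage h k m
  image h k = ξ mono isMono , record { ∈-image = λ x y → mk⇔
    (λ p → map (Equivalence.to (ξ-image-∈ M x y) p) λ c (a , eq) →
      let eq′ = Hom.trans (Hom.sym (⟨⟩∘ h k a)) eq in a , ⟨⟩-inj₁ eq′ , ⟨⟩-inj₂ eq′)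
    (λ p → Equivalence.from (ξ-image-∈ M x y) (map p λ c (a , h∘a≈ , k∘a≈) →
      a , Hom.trans (⟨⟩∘ h k a) (⟨⟩-cong h∘a≈ k∘a≈))) }
    where
    M = epiMono ⟨ h , k ⟩
    open EpiMonoFactorisation M

  -- In the internal language, `m y` is the direct image of `W y` under `h`.
  record IsPushforward {A B Y} (h : A ⇒ B) (W : Y ⇒ 𝒫₀ A) (m : Y ⇒ 𝒫₀ B)
         : Set (o ⊔ ℓ ⊔ e) where
    field
      ∈-pushforward : ∀ {T} (b : T ⇒ B) (y : T ⇒ Y) → (b ∈ᵗ (m ∘ y)) ⇔
        Locally T (λ {S} c → Σ[ a ∈ S ⇒ A ] (a ∈ᵗ (W ∘ (y ∘ c))) × h ∘ a ≈ b ∘ c)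

    to : ∀ {T} {b : T ⇒ B} {y : T ⇒ Y} → b ∈ᵗ (m ∘ y) →
         Locally T (λ {S} c → Σ[ a ∈ S ⇒ A ] (a ∈ᵗ (W ∘ (y ∘ c))) × h ∘ a ≈ b ∘ c)
    to = Equivalence.to (∈-pushforward _ _)

    from : ∀ {T} {b : T ⇒ B} {y : T ⇒ Y} →
           Locally T (λ {S} c → Σ[ a ∈ S ⇒ A ] (a ∈ᵗ (W ∘ (y ∘ c))) × h ∘ a ≈ b ∘ c) →
           b ∈ᵗ (m ∘ y)
    from = Equivalence.from (∈-pushforward _ _)

    push : ∀ {T} {a : T ⇒ A} {y : T ⇒ Y} → a ∈ᵗ (W ∘ y) → (h ∘ a) ∈ᵗ (m ∘ y)
    push p = from (pure (_ , ∈-resp Hom.refl (∘-congˡ (Hom.sym (identityʳ _))) p ,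
      Hom.sym (identityʳ _)))

  -- This takes the place of functoriality of `𝒫₁`. Preimages are chosen in two stages, and the two
  -- covers compose.
  pushforward-∘ : ∀ {A B C Y} {g : B ⇒ C} {h : A ⇒ B} {W : Y ⇒ 𝒫₀ A} {V : Y ⇒ 𝒫₀ B}
                  {m : Y ⇒ 𝒫₀ C} → IsPushforward g V m → IsPushforward h W V →
                  IsPushforward (g ∘ h) W m
  pushforward-∘ {g = g} {h} g-push h-push = record { ∈-pushforward = λ z y → mk⇔
    (λ z∈ → bind (G.to z∈) λ c (b , b∈ , g∘b≈) → map (H.to b∈) λ c′ (a , a∈ , h∘a≈) →
      a , ∈-resp Hom.refl (∘-congˡ (assoc y c c′)) a∈ , (begin
        (g ∘ h) ∘ a    ≈⟨ assoc g h a ⟩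
        g ∘ (h ∘ a)    ≈⟨ ∘-congˡ h∘a≈ ⟩
        g ∘ (b ∘ c′)   ≈⟨ pullˡ g∘b≈ ⟩
        (z ∘ c) ∘ c′   ≈⟨ assoc z c c′ ⟩
        z ∘ (c ∘ c′)   ∎))
    (λ p → G.from (map p λ c (a , a∈ , gh∘a≈) →
      h ∘ a , H.push a∈ , Hom.trans (Hom.sym (assoc g h a)) gh∘a≈)) }
    where
    module G = IsPushforward g-push
    module H = IsPushforward h-push

  -- A point of `E A` is an element paired with a subset containing it. Since `h ⁂ id` leaves the
  -- subset fixed, the preimages of `b` are taken inside the value of `W` at the given point.
  𝒫₁-pushforward : ∀ {A B Y} (h : A ⇒ B) (W : Y ⇒ 𝒫₀ A) → IsPushforward h W (𝒫₁ h ∘ W)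
  𝒫₁-pushforward {A} h W = record { ∈-pushforward = λ b y → mk⇔ (to b y) (from b y) }
    where
    M = epiMono ((h ⁂ id) ∘ ∈ᴾ A)

    Preimage : ∀ {T} (b : T ⇒ _) (y : T ⇒ _) → Set _
    Preimage {T} b y = Locally T (λ {S} c →
      Σ[ a ∈ S ⇒ A ] (a ∈ᵗ (W ∘ (y ∘ c))) × h ∘ a ≈ b ∘ c)

    to : ∀ {T} (b : T ⇒ _) (y : T ⇒ _) → b ∈ᵗ ((𝒫₁ h ∘ W) ∘ y) → Preimage b y
    to b y p = map
      (Equivalence.to (ξ-image-∈ M b (W ∘ y)) (∈-resp Hom.refl (assoc (𝒫₁ h) W y) p))
      λ c (u , eq) →
        let ∈u = ∈ᴾ A ∘ u
            eq′ : ⟨ h ∘ (π₁ ∘ ∈u) , id ∘ (π₂ ∘ ∈u) ⟩ ≈ ⟨ b ∘ c , (W ∘ y) ∘ c ⟩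
            eq′ = Hom.trans (Hom.sym (⁂∘⟨⟩ h id _ _))
              (Hom.trans (∘-congˡ (⟨⟩-η ∈u)) (Hom.trans (Hom.sym (assoc _ _ _)) eq))
        in π₁ ∘ ∈u ,
           (u , Hom.trans (Hom.sym (⟨⟩-η ∈u)) (⟨⟩-cong Hom.refl
             (Hom.trans (Hom.sym (identityˡ _)) (Hom.trans (⟨⟩-inj₂ eq′) (assoc W y c))))) ,
           ⟨⟩-inj₁ eq′

    from : ∀ {T} (b : T ⇒ _) (y : T ⇒ _) → Preimage b y → b ∈ᵗ ((𝒫₁ h ∘ W) ∘ y)
    from b y p = ∈-resp Hom.refl (Hom.sym (assoc (𝒫₁ h) W y))
      (Equivalence.from (ξ-image-∈ M b (W ∘ y)) (map p λ c (a , (u , eq) , h∘a≈) → u , (begin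
        ((h ⁂ id) ∘ ∈ᴾ A) ∘ u              ≈⟨ assoc _ _ _ ⟩
        (h ⁂ id) ∘ (∈ᴾ A ∘ u)              ≈⟨ ∘-congˡ eq ⟩
        (h ⁂ id) ∘ ⟨ a , W ∘ (y ∘ c) ⟩     ≈⟨ ⁂∘⟨⟩ h id _ _ ⟩
        ⟨ h ∘ a , id ∘ (W ∘ (y ∘ c)) ⟩     ≈⟨ ⟨⟩-cong h∘a≈ (Hom.trans (identityˡ _)
                                               (Hom.sym (assoc W y c))) ⟩
        ⟨ b ∘ c , (W ∘ y) ∘ c ⟩            ∎)))

module SimulationProof {o ℓ e p} {𝒞 : Category o ℓ e} (𝒯 : Topos 𝒞)
                       (F : Endofunctor 𝒞) (≤ : GoodOrder F p) where
  open Category 𝒞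
  open Topos 𝒯
  open ToposTheory 𝒯
  open Endofunctor F
  open GoodOrder ≤
  open Simulations 𝒯 F ≤
  open KripkeJoyal 𝒯

  private
    open module R {A} {B} = SetoidReasoning (hom-setoid A B)

  -- The order on `F` and its extension `≤𝒫` in terms of elements.

  ≤-reflexive : ∀ {X Y} {α β : X ⇒ F₀ Y} → α ≈ β → [ Y ] α ≤ β
  ≤-reflexive = IsPreorder.reflexive isPreorder

  ≤-trans : ∀ {X Y} {α β γ : X ⇒ F₀ Y} → [ Y ] α ≤ β → [ Y ] β ≤ γ → [ Y ] α ≤ γ
  ≤-trans = IsPreorder.trans isPreorder

  ≤-resp-≈ : ∀ {X Y} {α α′ β β′ : X ⇒ F₀ Y} → α ≈ α′ → β ≈ β′ → [ Y ] α ≤ β → [ Y ] α′ ≤ β′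
  ≤-resp-≈ p q α≤β = ≤-trans (≤-reflexive (Hom.sym p)) (≤-trans α≤β (≤-reflexive q))

  ≤-∘ : ∀ {X X′ Y} {α β : X ⇒ F₀ Y} (f : X′ ⇒ X) → [ Y ] α ≤ β → [ Y ] α ∘ f ≤ β ∘ f
  ≤-∘ f α≤β = ≤-resp-≈ F₁id F₁id (monotone f id α≤β)
    where
    F₁id : ∀ {A B} {h : A ⇒ F₀ B} → F₁ id ∘ h ≈ h
    F₁id = Hom.trans (∘-congʳ identity) (identityˡ _)

  F₁-≤ : ∀ {X Y Z} {α β : X ⇒ F₀ Y} (g : Y ⇒ Z) → [ Y ] α ≤ β → [ Z ] F₁ g ∘ α ≤ F₁ g ∘ β
  F₁-≤ g α≤β = ≤-resp-≈ (∘-congˡ (identityʳ _)) (∘-congˡ (identityʳ _)) (monotone id g α≤β)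

  -- The data of `≤𝒫` live over an epi onto `U f`. An element of `f` is a morphism into `U f`, and
  -- it lifts along that epi on a cover.
  ≤𝒫-local : ∀ {X Y T} {f g : X ⇒ 𝒫F₀ Y} → [ Y ] f ≤𝒫 g →
             (x : T ⇒ F₀ Y) (y : T ⇒ X) → x ∈ᵗ (f ∘ y) →
             Locally T (λ {S} c → Σ[ x′ ∈ S ⇒ F₀ Y ] (x′ ∈ᵗ (g ∘ (y ∘ c))) × [ Y ] x ∘ c ≤ x′)
  ≤𝒫-local {f = f} {g} (Z , u , q , q-epi , le , eq) x y p =
      S , c , c-epi , π₁ ∘ m⟨ g ⟩ ∘ (u ∘ s) ,
      ∈-resp Hom.refl (∘-congˡ (begin
        π₂ ∘ (m⟨ g ⟩ ∘ (u ∘ s))    ≈⟨ reassoc π₂ m⟨ g ⟩ u ⟨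
        (π₂ ∘ (m⟨ g ⟩ ∘ u)) ∘ s    ≈⟨ ∘-congʳ eq ⟨
        (π₂ ∘ (m⟨ f ⟩ ∘ q)) ∘ s    ≈⟨ Hom.trans (reassoc π₂ m⟨ f ⟩ q) (∘-congˡ over) ⟩
        π₂ ∘ ⟨ x ∘ c , y ∘ c ⟩     ≈⟨ π₂∘⟨⟩ _ _ ⟩
        y ∘ c                      ∎)) (m⟨⟩-∈ g (u ∘ s)) ,
      ≤-resp-≈ (begin
        (π₁ ∘ (m⟨ f ⟩ ∘ q)) ∘ s    ≈⟨ Hom.trans (reassoc π₁ m⟨ f ⟩ q) (∘-congˡ over) ⟩
        π₁ ∘ ⟨ x ∘ c , y ∘ c ⟩     ≈⟨ π₁∘⟨⟩ _ _ ⟩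
        x ∘ c                      ∎) (reassoc π₁ m⟨ g ⟩ u) (≤-∘ s le)
    where
    v = Equivalence.from (∈-m⟨⟩ f x y) p
    lift = epi-lifts q-epi (proj₁ v)
    S = proj₁ lift
    c = proj₁ (proj₂ lift)
    c-epi = proj₁ (proj₂ (proj₂ lift))
    s = proj₁ (proj₂ (proj₂ (proj₂ lift)))

    reassoc : ∀ {A B C D} (a : C ⇒ D) (b : B ⇒ C) (d : A ⇒ B) →
              ∀ {A′} {k : A′ ⇒ A} → (a ∘ (b ∘ d)) ∘ k ≈ a ∘ (b ∘ (d ∘ k))
    reassoc a b d = Hom.trans (assoc _ _ _) (∘-congˡ (assoc _ _ _))

    over : m⟨ f ⟩ ∘ (q ∘ s) ≈ ⟨ x ∘ c , y ∘ c ⟩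
    over = Hom.trans (∘-congˡ (proj₂ (proj₂ (proj₂ (proj₂ lift)))))
      (Hom.trans (pullˡ (proj₂ v)) (⟨⟩∘ x y c))

  -- The hypothesis is applied to the generic element of `f`, given by the projections of `m⟨ f ⟩`.
  -- The resulting cover is the epi in `≤𝒫`, and `x′` yields the morphism into `U g`.
  local-≤𝒫 : ∀ {X Y} (f g : X ⇒ 𝒫F₀ Y) →
             (∀ {T} (x : T ⇒ F₀ Y) (y : T ⇒ X) → x ∈ᵗ (f ∘ y) →
              Locally T (λ {S} c →
                Σ[ x′ ∈ S ⇒ F₀ Y ] (x′ ∈ᵗ (g ∘ (y ∘ c))) × [ Y ] x ∘ c ≤ x′)) →
             [ Y ] f ≤𝒫 g
  local-≤𝒫 f g local =
    let (S , c , c-epi , x′ , x′∈g , le) =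
          local (π₁ ∘ m⟨ f ⟩ ∘ id) (π₂ ∘ m⟨ f ⟩ ∘ id) (m⟨⟩-∈ f id)
        (u , eq) = Equivalence.from (∈-m⟨⟩ g x′ ((π₂ ∘ m⟨ f ⟩ ∘ id) ∘ c)) x′∈g
        drop-id : ∀ {A} (π : F₀ _ ×ᵒ _ ⇒ A) → (π ∘ m⟨ f ⟩ ∘ id) ∘ c ≈ π ∘ m⟨ f ⟩ ∘ c
        drop-id π = Hom.trans (assoc _ _ _) (∘-congˡ (∘-congʳ (identityʳ _)))
    in S , u , c , c-epi ,
       ≤-resp-≈ (drop-id π₁) (Hom.sym (Hom.trans (∘-congˡ eq) (π₁∘⟨⟩ _ _))) le ,
       Hom.trans (Hom.sym (drop-id π₂)) (Hom.sym (Hom.trans (∘-congˡ eq) (π₂∘⟨⟩ _ _)))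

  -- Simulation and homomorphism conditions in the internal language.

  𝒫F₁-pushforward : ∀ {X Y R} {f : X ⇒ Y} {W : R ⇒ 𝒫F₀ X} →
                    IsPushforward (F₁ f) W (𝒫F₁ f ∘ W)
  𝒫F₁-pushforward {f = f} {W} = 𝒫₁-pushforward (F₁ f) W

  F₁-pushforward-∘ : ∀ {X Y Z R} {g : Y ⇒ Z} {f : X ⇒ Y} {W : R ⇒ 𝒫F₀ X} {V : R ⇒ 𝒫F₀ Y}
                     {m : R ⇒ 𝒫F₀ Z} → IsPushforward (F₁ g) V m → IsPushforward (F₁ f) W V →
                     IsPushforward (F₁ (g ∘ f)) W m
  F₁-pushforward-∘ {g = g} {f} g-push f-push = record { ∈-pushforward = λ z y → mk⇔
    (λ z∈ → map (P.to z∈) λ c (a , a∈ , eq) →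
      a , a∈ , Hom.trans (∘-congʳ (homomorphism g f)) eq)
    (λ p → P.from (map p λ c (a , a∈ , eq) →
      a , a∈ , Hom.trans (∘-congʳ (Hom.sym (homomorphism g f))) eq)) }
    where module P = IsPushforward (pushforward-∘ g-push f-push)

  -- In the internal language: ∀ ρ. ∃ t ∈ W ρ. α (f ρ) ≤ F f t.
  Forth : ∀ {X R} → X ⇒ F₀ X → R ⇒ X → R ⇒ 𝒫F₀ R → Set _
  Forth {X} {R} α f W = Locally R (λ {S} c →
    Σ[ t ∈ S ⇒ F₀ R ] (t ∈ᵗ (W ∘ c)) × [ X ] (α ∘ f) ∘ c ≤ F₁ f ∘ t)

  -- In the internal language: ∀ ρ. ∀ t ∈ W ρ. F g t ≤ β (g ρ).
  Back : ∀ {Y R} → Y ⇒ F₀ Y → R ⇒ Y → R ⇒ 𝒫F₀ R → Set _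
  Back {Y} {R} β g W = ∀ T (t : T ⇒ F₀ R) (ρ : T ⇒ R) → t ∈ᵗ (W ∘ ρ) →
    Locally T (λ c → [ Y ] (F₁ g ∘ t) ∘ c ≤ ((β ∘ g) ∘ ρ) ∘ c)

  -- One of the two inclusions making up the homomorphism equation: the singleton of `α (f ρ)` lies
  -- in the direct image of `W ρ`.
  Forth≈ : ∀ {X R} → X ⇒ F₀ X → R ⇒ X → R ⇒ 𝒫F₀ R → Set _
  Forth≈ {X} {R} α f W = Locally R (λ {S} c →
    Σ[ t ∈ S ⇒ F₀ R ] (t ∈ᵗ (W ∘ c)) × (α ∘ f) ∘ c ≈ F₁ f ∘ t)

  -- The opposite inclusion. It is stated without a cover because equality descends along epis,
  -- which is not assumed of `≤`.
  Back≈ : ∀ {X R} → X ⇒ F₀ X → R ⇒ X → R ⇒ 𝒫F₀ R → Set _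
  Back≈ {X} {R} α f W = ∀ T (t : T ⇒ F₀ R) (ρ : T ⇒ R) → t ∈ᵗ (W ∘ ρ) →
    F₁ f ∘ t ≈ (α ∘ f) ∘ ρ

  module _ {X R} {α : X ⇒ F₀ X} {f : R ⇒ X} {W : R ⇒ 𝒫F₀ R} {m n : R ⇒ 𝒫F₀ X}
           (push : IsPushforward (F₁ f) W m) (sing : IsSingleton (α ∘ f) n) where
    private
      module P = IsPushforward push
      module N = IsSingleton sing

    ≤𝒫⇒Forth : [ X ] n ≤𝒫 m → Forth α f W
    ≤𝒫⇒Forth le = bind (≤𝒫-local le (α ∘ f) id (N.from (Hom.sym (identityʳ _))))
      λ c (x , x∈ , αf≤x) → map (P.to x∈) λ c′ (t , t∈ , F₁f∘t≈) →
        t , ∈-resp Hom.refl (∘-congˡ (∘-congʳ (identityˡ c))) t∈ ,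
        ≤-resp-≈ (assoc _ _ _) (Hom.sym F₁f∘t≈) (≤-∘ c′ αf≤x)

    -- The witness lives over a single cover `c` of `R`; it reaches an arbitrary point `ρ` by
    -- lifting `ρ` locally along `c`.
    Forth⇒≤𝒫 : Forth α f W → [ X ] n ≤𝒫 m
    Forth⇒≤𝒫 (S , c , c-epi , t , t∈ , αf≤) = local-≤𝒫 n m λ x ρ x∈ →
      map (epi-lifts c-epi ρ) λ c′ (s , c∘s≈) →
        F₁ f ∘ (t ∘ s) ,
        P.push (∈-resp Hom.refl (Hom.trans (assoc W c s) (∘-congˡ c∘s≈)) (∈-∘ s t∈)) ,
        ≤-resp-≈
          (begin
            ((α ∘ f) ∘ c) ∘ s    ≈⟨ assoc _ _ _ ⟩
            (α ∘ f) ∘ (c ∘ s)    ≈⟨ ∘-congˡ c∘s≈ ⟩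
            (α ∘ f) ∘ (ρ ∘ c′)   ≈⟨ pullˡ (Hom.sym (N.to x∈)) ⟩
            x ∘ c′               ∎)
          (assoc _ _ _) (≤-∘ s αf≤)

    -- The upper bound supplied by `≤𝒫` lies in a singleton, which identifies it.
    ≤𝒫⇒Back : [ X ] m ≤𝒫 n → Back α f W
    ≤𝒫⇒Back le T t ρ t∈ = map (≤𝒫-local le (F₁ f ∘ t) ρ (P.push t∈)) λ c (x , x∈ , F₁f∘t≤x) →
      ≤-trans F₁f∘t≤x (≤-reflexive (Hom.trans (N.to x∈) (Hom.sym (assoc _ _ _))))

    Back⇒≤𝒫 : Back α f W → [ X ] m ≤𝒫 n
    Back⇒≤𝒫 back = local-≤𝒫 m n λ x ρ x∈ →
      bind (P.to x∈) λ c (t , t∈ , F₁f∘t≈) → map (back _ t (ρ ∘ c) t∈) λ c′ F₁f∘t≤ →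
        (α ∘ f) ∘ (ρ ∘ (c ∘ c′)) , N.from Hom.refl ,
        ≤-resp-≈ (Hom.trans (∘-congʳ F₁f∘t≈) (assoc x c c′))
          (Hom.trans (assoc _ _ _) (∘-congˡ (assoc ρ c c′))) F₁f∘t≤

    ≈⇒Forth≈ : m ≈ n → Forth≈ α f W
    ≈⇒Forth≈ m≈n = map
      (P.to (∈-resp Hom.refl (∘-congʳ (Hom.sym m≈n)) (N.from {y = id} (Hom.sym (identityʳ _)))))
      λ c (t , t∈ , F₁f∘t≈) → t , ∈-resp Hom.refl (∘-congˡ (identityˡ c)) t∈ , Hom.sym F₁f∘t≈

    ≈⇒Back≈ : m ≈ n → Back≈ α f W
    ≈⇒Back≈ m≈n T t ρ t∈ = N.to (∈-resp Hom.refl (∘-congʳ m≈n) (P.push t∈))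

    -- Extensionality of power-objects reduces this to two inclusions: `back` gives that of `m` in
    -- `n`, and the witness `t`, moved along local lifts of `ρ`, gives the converse.
    Forth≈,Back≈⇒≈ : Forth≈ α f W → Back≈ α f W → m ≈ n
    Forth≈,Back≈⇒≈ (S , c , c-epi , t , t∈ , αf≈) back = 𝒫-ext m n λ x ρ → mk⇔
      (λ x∈ → N.from (≈-local (map (P.to x∈) λ c′ (t′ , t′∈ , F₁f∘t′≈) → begin
        x ∘ c′                ≈⟨ F₁f∘t′≈ ⟨
        F₁ f ∘ t′             ≈⟨ back _ t′ (ρ ∘ c′) t′∈ ⟩
        (α ∘ f) ∘ (ρ ∘ c′)    ≈⟨ assoc _ _ _ ⟨
        ((α ∘ f) ∘ ρ) ∘ c′    ∎)))
      (λ x∈ → P.from (map (epi-lifts c-epi ρ) λ c′ (s , c∘s≈) →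
        t ∘ s , ∈-resp Hom.refl (Hom.trans (assoc W c s) (∘-congˡ c∘s≈)) (∈-∘ s t∈) , (begin
          F₁ f ∘ (t ∘ s)        ≈⟨ pullˡ (Hom.sym αf≈) ⟩
          ((α ∘ f) ∘ c) ∘ s     ≈⟨ assoc _ _ _ ⟩
          (α ∘ f) ∘ (c ∘ s)     ≈⟨ ∘-congˡ c∘s≈ ⟩
          (α ∘ f) ∘ (ρ ∘ c′)    ≈⟨ pullˡ (Hom.sym (N.to x∈)) ⟩
          x ∘ c′                ∎)))

  -- Transport of a coalgebra along a morphism by unions.

  -- W ρ is the union of the images of γ z under F q, over all z with q z = ρ.
  union-along : ∀ {Z R} (γ : Z ⇒ 𝒫F₀ Z) (q : Z ⇒ R) →
    Σ[ W ∈ R ⇒ 𝒫F₀ R ] IsImage (F₁ q ∘ π₁ ∘ m⟨ γ ⟩) (q ∘ π₂ ∘ m⟨ γ ⟩) W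
  union-along γ q = image _ _

  module Union {Z R} {γ : Z ⇒ 𝒫F₀ Z} {q : Z ⇒ R} {W : R ⇒ 𝒫F₀ R}
               (W-union : IsImage (F₁ q ∘ π₁ ∘ m⟨ γ ⟩) (q ∘ π₂ ∘ m⟨ γ ⟩) W) where
    open IsImage W-union

    F₁-collapse : ∀ {V T} {a : R ⇒ V} {b : Z ⇒ V} {s : T ⇒ F₀ Z} →
                  a ∘ q ≈ b → F₁ a ∘ (F₁ q ∘ s) ≈ F₁ b ∘ s
    F₁-collapse eq = pullˡ (Hom.trans (Hom.sym (homomorphism _ _)) (F-resp-≈ eq))

    ∈-union : ∀ {T} (s : T ⇒ F₀ Z) (z : T ⇒ Z) → s ∈ᵗ (γ ∘ z) → (F₁ q ∘ s) ∈ᵗ (W ∘ (q ∘ z))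
    ∈-union s z s∈ with u , eq ← Equivalence.from (∈-m⟨⟩ γ s z) s∈ =
      ∈-resp (component (F₁ q) π₁ (π₁∘⟨⟩ s z)) (∘-congˡ (component q π₂ (π₂∘⟨⟩ s z)))
        (contains u)
      where
      component : ∀ {A B} (h : A ⇒ B) (π : F₀ Z ×ᵒ Z ⇒ A) {x} → π ∘ ⟨ s , z ⟩ ≈ x →
                  (h ∘ π ∘ m⟨ γ ⟩) ∘ u ≈ h ∘ x
      component h π eqx = Hom.trans (assoc _ _ _) (∘-congˡ
        (Hom.trans (assoc _ _ _) (Hom.trans (∘-congˡ eq) eqx)))

    union-∈ : ∀ {T} {t : T ⇒ F₀ R} {ρ : T ⇒ R} → t ∈ᵗ (W ∘ ρ) →
              Locally T (λ {S} c → Σ[ s ∈ S ⇒ F₀ Z ] Σ[ z ∈ S ⇒ Z ]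
                (s ∈ᵗ (γ ∘ z)) × F₁ q ∘ s ≈ t ∘ c × q ∘ z ≈ ρ ∘ c)
    union-∈ t∈ = map (to t∈) λ c (u , eq₁ , eq₂) →
      _ , _ , m⟨⟩-∈ γ u ,
      Hom.trans (Hom.sym (reassoc _ _ _)) eq₁ , Hom.trans (Hom.sym (reassoc _ _ _)) eq₂
      where
      reassoc : ∀ {A B C D E} (h : D ⇒ E) (π : C ⇒ D) (k : B ⇒ C) {u : A ⇒ B} →
                (h ∘ π ∘ k) ∘ u ≈ h ∘ π ∘ k ∘ u
      reassoc h π k = Hom.trans (assoc _ _ _) (∘-congˡ (assoc _ _ _))

    -- Every point of `R` comes locally from `Z`, so the cover `c` of `Z` becomes the cover `q ∘ c`
    -- of `R`, and `F₁ q` carries the witness across.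
    union-Forth : ∀ {X} {α : X ⇒ F₀ X} {f : Z ⇒ X} {a : R ⇒ X} → Epi q → a ∘ q ≈ f →
                  Forth≈ α f γ → Forth α a W
    union-Forth {α = α} {f} {a} q-epi a∘q≈f (S , c , c-epi , t , t∈ , αf≈) =
      S , q ∘ c , epi-∘ q-epi c-epi , F₁ q ∘ t , ∈-union t c t∈ , ≤-reflexive (begin
        (α ∘ a) ∘ (q ∘ c)    ≈⟨ pullˡ (Hom.trans (assoc α a q) (∘-congˡ a∘q≈f)) ⟩
        (α ∘ f) ∘ c          ≈⟨ αf≈ ⟩
        F₁ f ∘ t             ≈⟨ F₁-collapse a∘q≈f ⟨
        F₁ a ∘ (F₁ q ∘ t)    ∎)

    -- Locally, an element of the union is `F₁ q ∘ s` with `s` in `γ`, and applying `F₁ b` to it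
    -- gives `F₁ g ∘ s`, to which `back` applies.
    union-Back : ∀ {Y} {β : Y ⇒ F₀ Y} {g : Z ⇒ Y} {b : R ⇒ Y} → b ∘ q ≈ g →
                 Back β g γ → Back β b W
    union-Back {β = β} {g} {b} b∘q≈g back T t ρ t∈ =
      bind (union-∈ t∈) λ c (s , z , s∈ , F₁q∘s≈ , q∘z≈) → map (back _ s z s∈) λ c′ F₁g∘s≤ →
        ≤-resp-≈
          (begin
            (F₁ g ∘ s) ∘ c′             ≈⟨ ∘-congʳ (F₁-collapse b∘q≈g) ⟨
            (F₁ b ∘ (F₁ q ∘ s)) ∘ c′    ≈⟨ ∘-congʳ (∘-congˡ F₁q∘s≈) ⟩
            (F₁ b ∘ (t ∘ c)) ∘ c′       ≈⟨ ∘-congʳ (assoc _ _ _) ⟨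
            ((F₁ b ∘ t) ∘ c) ∘ c′       ≈⟨ assoc _ _ _ ⟩
            (F₁ b ∘ t) ∘ (c ∘ c′)       ∎)
          (begin
            ((β ∘ g) ∘ z) ∘ c′          ≈⟨ ∘-congʳ (∘-congʳ (∘-congˡ b∘q≈g)) ⟨
            ((β ∘ (b ∘ q)) ∘ z) ∘ c′    ≈⟨ ∘-congʳ (∘-congʳ (assoc _ _ _)) ⟨
            (((β ∘ b) ∘ q) ∘ z) ∘ c′    ≈⟨ ∘-congʳ (assoc _ _ _) ⟩
            ((β ∘ b) ∘ (q ∘ z)) ∘ c′    ≈⟨ ∘-congʳ (∘-congˡ q∘z≈) ⟩
            ((β ∘ b) ∘ (ρ ∘ c)) ∘ c′    ≈⟨ ∘-congʳ (assoc _ _ _) ⟨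
            (((β ∘ b) ∘ ρ) ∘ c) ∘ c′    ≈⟨ assoc _ _ _ ⟩
            ((β ∘ b) ∘ ρ) ∘ (c ∘ c′)    ∎)
          F₁g∘s≤

  -- From inequality to equality by the lifting condition.

  -- Condition (2) of a good order replaces the elements t of W with α (f ρ) ≤ F f t by
  -- elements t′ ≤ t with α (f ρ) = F f t′; these t′ form γ.
  strengthen : ∀ {X Y R} {α : X ⇒ F₀ X} {β : Y ⇒ F₀ Y} {f : R ⇒ X} {g : R ⇒ Y}
               {W : R ⇒ 𝒫F₀ R} → Forth α f W → Back β g W →
               Σ[ γ ∈ R ⇒ 𝒫F₀ R ] Forth≈ α f γ × Back≈ α f γ × Back β g γ
  strengthen {R = R} {α} {β} {f} {g} {W} (D , d , d-epi , t , t∈ , αf≤) back =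
    -- Condition (2) concerns actual morphisms, so it is used over the cover `D`, where the
    -- existential in `Forth` has the witness `t`.
    strengthen-by (lifting ((α ∘ f) ∘ d) t f αf≤)
    where
    module _ {t′ : D ⇒ F₀ R} (t′≤t : [ R ] t′ ≤ t) (αf≈ : (α ∘ f) ∘ d ≈ F₁ f ∘ t′)
             {γ : R ⇒ 𝒫F₀ R} (γ-image : IsImage t′ d γ) where
      open IsImage γ-image

      forth≈ : Forth≈ α f γ
      forth≈ = D , d , d-epi , t′ ,
        ∈-resp (identityʳ t′) (∘-congˡ (identityʳ d)) (contains id) , αf≈

      back≈ : Back≈ α f γ
      back≈ T s ρ s∈ = ≈-local (map (to s∈) λ c (a , t′∘a≈ , d∘a≈) → begin
        (F₁ f ∘ s) ∘ c         ≈⟨ assoc _ _ _ ⟩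
        F₁ f ∘ (s ∘ c)         ≈⟨ ∘-congˡ t′∘a≈ ⟨
        F₁ f ∘ (t′ ∘ a)        ≈⟨ pullˡ (Hom.sym αf≈) ⟩
        ((α ∘ f) ∘ d) ∘ a      ≈⟨ assoc _ _ _ ⟩
        (α ∘ f) ∘ (d ∘ a)      ≈⟨ ∘-congˡ d∘a≈ ⟩
        (α ∘ f) ∘ (ρ ∘ c)      ≈⟨ assoc _ _ _ ⟨
        ((α ∘ f) ∘ ρ) ∘ c      ∎)

      back′ : Back β g γ
      -- An element of `γ` is locally `t′ ∘ a`, which lies below the element `t ∘ a` of `W`; the
      -- given `back` bounds the latter.
      back′ T s ρ s∈ = bind (to s∈) λ c (a , t′∘a≈ , d∘a≈) → map
        (back _ (t ∘ a) (ρ ∘ c)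
          (∈-resp Hom.refl (Hom.trans (assoc W d a) (∘-congˡ d∘a≈)) (∈-∘ a t∈)))
        λ c′ F₁g∘t∘a≤ → ≤-trans
          (≤-resp-≈
            (begin
              (F₁ g ∘ (t′ ∘ a)) ∘ c′    ≈⟨ ∘-congʳ (∘-congˡ t′∘a≈) ⟩
              (F₁ g ∘ (s ∘ c)) ∘ c′     ≈⟨ ∘-congʳ (assoc _ _ _) ⟨
              ((F₁ g ∘ s) ∘ c) ∘ c′     ≈⟨ assoc _ _ _ ⟩
              (F₁ g ∘ s) ∘ (c ∘ c′)     ∎)
            Hom.refl (≤-∘ c′ (F₁-≤ g (≤-∘ a t′≤t))))
          (≤-resp-≈ Hom.refl
            (Hom.trans (∘-congʳ (Hom.sym (assoc _ _ _))) (assoc _ _ _)) F₁g∘t∘a≤)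

    strengthen-by : Σ[ t′ ∈ D ⇒ F₀ R ] ([ R ] t′ ≤ t) × (α ∘ f) ∘ d ≈ F₁ f ∘ t′ →
                    Σ[ γ ∈ R ⇒ 𝒫F₀ R ] Forth≈ α f γ × Back≈ α f γ × Back β g γ
    strengthen-by (t′ , t′≤t , αf≈) = proj₁ γ , forth≈ t′≤t αf≈ (proj₂ γ) ,
      back≈ t′≤t αf≈ (proj₂ γ) , back′ t′≤t αf≈ (proj₂ γ)
      where γ = image t′ d

  -- Translation of witnesses and homomorphisms into the internal language.

  -- Unfolding 𝒫F₁ in a conversion check is prohibitively expensive. Leaving the type of r
  -- to be inferred and supplying the implicit f keeps both sides syntactically equal.
  HasWitness⇔ : ∀ {X Y R} {α : X ⇒ F₀ X} {β : Y ⇒ F₀ Y} {r} → HasWitness {X} {Y} {R} α β r ⇔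
                (Σ[ W ∈ R ⇒ 𝒫F₀ R ] Forth α (π₁ ∘ r) W × Back β (π₂ ∘ r) W)
  HasWitness⇔ {r = r} = mk⇔
    (λ (W , left , right) → let r-push = 𝒫F₁-pushforward {f = r} {W} in W ,
      ≤𝒫⇒Forth (F₁-pushforward-∘ (𝒫F₁-pushforward {f = π₁}) r-push) η-singleton left ,
      ≤𝒫⇒Back (F₁-pushforward-∘ (𝒫F₁-pushforward {f = π₂}) r-push) η-singleton right)
    (λ (W , forth , back) → let r-push = 𝒫F₁-pushforward {f = r} {W} in W ,
      Forth⇒≤𝒫 (F₁-pushforward-∘ (𝒫F₁-pushforward {f = π₁}) r-push) η-singleton forth ,
      Back⇒≤𝒫 (F₁-pushforward-∘ (𝒫F₁-pushforward {f = π₂}) r-push) η-singleton back)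

  η∘-singleton : ∀ {X R} {α : X ⇒ F₀ X} {f : R ⇒ X} →
                 IsSingleton (α ∘ f) ((η (F₀ X) ∘ α) ∘ f)
  η∘-singleton {X} {α = α} {f} = record { ∈-singleton = λ x ρ → mk⇔
    (λ x∈ → N.to (∈-resp Hom.refl (∘-congʳ (assoc (η (F₀ X)) α f)) x∈))
    (λ x≈ → ∈-resp Hom.refl (∘-congʳ (Hom.sym (assoc (η (F₀ X)) α f))) (N.from x≈)) }
    where module N = IsSingleton (η-singleton {a = α ∘ f})

  IsHomomorphism⇔ : ∀ {X R} {γ : R ⇒ 𝒫F₀ R} {α : X ⇒ F₀ X} {f : R ⇒ X} →
    IsHomomorphism γ (η (F₀ X) ∘ α) f ⇔ (Forth≈ α f γ × Back≈ α f γ)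
  IsHomomorphism⇔ {γ = γ} {α} {f} = mk⇔
    (λ hom → ≈⇒Forth≈ {α = α} {f} {γ} 𝒫f∘γ-push α∘f-sing hom ,
             ≈⇒Back≈ {α = α} {f} {γ} 𝒫f∘γ-push α∘f-sing hom)
    (λ (forth , back) → Forth≈,Back≈⇒≈ {α = α} {f} {γ} 𝒫f∘γ-push α∘f-sing forth back)
    where
    𝒫f∘γ-push = 𝒫F₁-pushforward {f = f} {γ}
    α∘f-sing = η∘-singleton {α = α} {f}

  IsLaxHomomorphism⇔ : ∀ {Y R} {γ : R ⇒ 𝒫F₀ R} {β : Y ⇒ F₀ Y} {g : R ⇒ Y} →
    IsLaxHomomorphism γ (η (F₀ Y) ∘ β) g ⇔ Back β g γ
  IsLaxHomomorphism⇔ {γ = γ} {β} {g} = mk⇔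
    (≤𝒫⇒Back {α = β} {g} {γ} 𝒫g∘γ-push β∘g-sing)
    (Back⇒≤𝒫 {α = β} {g} {γ} 𝒫g∘γ-push β∘g-sing)
    where
    𝒫g∘γ-push = 𝒫F₁-pushforward {f = g} {γ}
    β∘g-sing = η∘-singleton {α = β} {g}

-- Simulations and spans through a pair of points.

theorem5p20 : ∀ {o ℓ e p} {𝒞 : Category o ℓ e} (𝒯 : Topos 𝒞) (F : Endofunctor 𝒞) (≤ : GoodOrder F p) →
    let open Category 𝒞
        open Topos 𝒯
        open ToposTheory 𝒯
        open Endofunctor F
        open Simulations 𝒯 F ≤
    in
    ∀ {X Y ∗ : Obj} (α : X ⇒ F₀ X) (β : Y ⇒ F₀ Y) (p : ∗ ⇒ X) (q : ∗ ⇒ Y) →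
    (∃[ R ] Σ[ r ∈ R ⇒ X ×ᵒ Y ]
      Mono r ×
      RepresentsToposalAMSimulation α β r ×
      Σ[ c ∈ ∗ ⇒ R ] r ∘ c ≈ ⟨ p , q ⟩)
    ⇔
    (∃[ Z ] Σ[ f ∈ Z ⇒ X ] Σ[ g ∈ Z ⇒ Y ] Σ[ γ ∈ Z ⇒ 𝒫F₀ Z ]
      IsHomomorphism γ (η (F₀ X) ∘ α) f ×
      IsLaxHomomorphism γ (η (F₀ Y) ∘ β) g ×
      Σ[ w ∈ ∗ ⇒ Z ] f ∘ w ≈ p × g ∘ w ≈ q)
theorem5p20 {𝒞 = 𝒞} 𝒯 F ≤ {X} {Y} {∗} α β p q = mk⇔ simulation⇒span span⇒simulation
  where
  open Category 𝒞
  open Topos 𝒯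
  open ToposTheory 𝒯
  open Endofunctor F
  open Simulations 𝒯 F ≤
  open KripkeJoyal 𝒯
  open SimulationProof 𝒯 F ≤

  SimulationThrough⟨p,q⟩ = ∃[ R ] Σ[ r ∈ R ⇒ X ×ᵒ Y ]
    Mono r ×
    RepresentsToposalAMSimulation α β r ×
    Σ[ c ∈ ∗ ⇒ R ] r ∘ c ≈ ⟨ p , q ⟩

  SpanThrough⟨p,q⟩ = ∃[ Z ] Σ[ f ∈ Z ⇒ X ] Σ[ g ∈ Z ⇒ Y ] Σ[ γ ∈ Z ⇒ 𝒫F₀ Z ]
    IsHomomorphism γ (η (F₀ X) ∘ α) f ×
    IsLaxHomomorphism γ (η (F₀ Y) ∘ β) g ×
    Σ[ w ∈ ∗ ⇒ Z ] f ∘ w ≈ p × g ∘ w ≈ q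

  coalgebra⇒span : ∀ {R} {f : R ⇒ X} {g : R ⇒ Y} {w : ∗ ⇒ R} → f ∘ w ≈ p → g ∘ w ≈ q →
    Σ[ γ ∈ R ⇒ 𝒫F₀ R ] Forth≈ α f γ × Back≈ α f γ × Back β g γ → SpanThrough⟨p,q⟩
  coalgebra⇒span {R} {f} {g} {w} f∘w≈p g∘w≈q (γ , forth , back , lax) =
    R , f , g , γ , Equivalence.from IsHomomorphism⇔ (forth , back) ,
    Equivalence.from IsLaxHomomorphism⇔ lax , w , f∘w≈p , g∘w≈q

  simulation⇒span : SimulationThrough⟨p,q⟩ → SpanThrough⟨p,q⟩
  -- The apex of the span is `R` itself, with the two components of `r` as legs and `c` as the
  -- point.
  simulation⇒span (R , r , r-mono , sim , c , r∘c≈) = coalgebra⇒span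
    (Hom.trans (assoc π₁ r c) (Hom.trans (∘-congˡ r∘c≈) (π₁∘⟨⟩ p q)))
    (Hom.trans (assoc π₂ r c) (Hom.trans (∘-congˡ r∘c≈) (π₂∘⟨⟩ p q)))
    (strengthen (proj₁ (proj₂ witness)) (proj₂ (proj₂ witness)))
    where
    id-iso : R ≅ R
    id-iso = record { to = id ; from = id ; to∘from = identityˡ id ; from∘to = identityˡ id }

    witness = Equivalence.to HasWitness⇔ (sim r r-mono (id-iso , identityʳ r))

  union⇒witness : ∀ {Z R} {f : Z ⇒ X} {g : Z ⇒ Y} {γ : Z ⇒ 𝒫F₀ Z} {r : R ⇒ X ×ᵒ Y} {q : Z ⇒ R} →
    Epi q → r ∘ q ≈ ⟨ f , g ⟩ → Forth≈ α f γ → Back β g γ →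
    Σ[ W ∈ R ⇒ 𝒫F₀ R ] IsImage (F₁ q ∘ π₁ ∘ m⟨ γ ⟩) (q ∘ π₂ ∘ m⟨ γ ⟩) W → HasWitness α β r
  union⇒witness {r = r} {q} q-epi r∘q≈ forth lax (W , W-union) =
    Equivalence.from HasWitness⇔ (W ,
      union-Forth q-epi
        (Hom.trans (assoc π₁ r q) (Hom.trans (∘-congˡ r∘q≈) (π₁∘⟨⟩ _ _))) forth ,
      union-Back
        (Hom.trans (assoc π₂ r q) (Hom.trans (∘-congˡ r∘q≈) (π₂∘⟨⟩ _ _))) lax)
    where open Union W-union

  span⇒simulation : SpanThrough⟨p,q⟩ → SimulationThrough⟨p,q⟩
  span⇒simulation (Z , f , g , γ , f-hom , g-lax , w , f∘w≈p , g∘w≈q) =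
      Im , mono , isMono ,
      -- For any mono `r′` representing the image, the epi part followed by the isomorphism `i` is
      -- again an epi factoring `⟨ f , g ⟩` through `r′`, so the union is formed along that
      -- composite.
      (λ r′ _ (i , r′∘i≈) → union⇒witness
        (epi-∘ (iso-epi i) isEpi) (Hom.trans (pullˡ r′∘i≈) factorise)
        (proj₁ (Equivalence.to IsHomomorphism⇔ f-hom))
        (Equivalence.to IsLaxHomomorphism⇔ g-lax)
        (union-along γ (_≅_.to i ∘ epi))) ,
      epi ∘ w ,
      Hom.trans (pullˡ factorise) (Hom.trans (⟨⟩∘ f g w) (⟨⟩-cong f∘w≈p g∘w≈q))
    where open EpiMonoFactorisation (epiMono ⟨ f , g ⟩)
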